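{- There exists a constant $\alpha>0$ such that the following holds. For even $n$, let $G=H\cup M$, where $H$ is a Hamiltonian cycle on a set of $n$ vertices and $M$ is a uniformly random perfect matching on the same $n$ vertices (i.e. of the complete graph $K_n$). Then with high probability $\alpha n$ cops do not suffice to catch the robber on $G$; that is, $\Pr[\mathrm{ent}(G)>\alpha n]\to1$ as $n\to\infty$ through even integers.
   Context: Entanglement game on a finite undirected graph $G$ with $k$ cops: First the robber chooses a starting vertex, and all $k$ cops are outside the graph. In every turn, the cops either all stay where they are, or exactly one of them flies (from wherever it is, on or off the graph) to the current position of the robber. Regardless of which of these happened, the robber then has to move to a neighbor of his current position that is not occupied by a cop. If there is no such neighbor, the cops win. The robber wins if he can run away indefinitely. Both sides have full information. The entanglement number $\mathrm{ent}(G)$ is the minimal integer $k$ such that $k$ cops have a strategy to catch the robber on $G$. "$\alpha n$ cops do not suffice" means that no integer number $k\le\alpha n$ of cops can catch the robber, i.e. $\mathrm{ent}(G)>\alpha n$. $H\cup M$ is the graph on the $n$ vertices whose edge set is the union of the edge sets of $H$ and $M$. The cycle $H$ is fixed (by symmetry it does not matter which one). "With high probability" means with probability tending to $1$ as $n\to\infty$. -}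

module Defs where

open import Data.Bool.Base using (Bool; true; false; T)
open import Data.Bool.Properties using (T?)
open import Data.Fin.Base as Fin using (Fin; toℕ)
open import Data.Fin.Properties as Fin using (any?; all?; ¬∀⟶∃¬; pigeonhole)
open import Data.Integer.Base using (+_)
open import Data.List.Base as List
  using (List; []; _∷_; length; filter; mapMaybe; cartesianProduct; cartesianProductWith; allFin)
open import Data.List.Membership.Propositional using (_∈_; _∉_; find; lose)
open import Data.List.Membership.Propositional.Properties
  using (∈-allFin; ∈-map⁺; ∈-filter⁺; ∈-cartesianProduct⁺; ∈-cartesianProductWith⁺)
import Data.List.Membership.DecPropositional as DecMembership
open import Data.List.Properties using (filter-notAll)
import Data.List.Relation.Unary.Any as Any
open import Data.List.Relation.Unary.Any using (here; there)
open import Data.Maybe.Base as Maybe using (Maybe; just; nothing)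
import Data.Maybe.Properties as Maybe
open import Data.Nat.Base as ℕ using (ℕ; zero; suc; z≤n; s≤s)
import Data.Nat.Properties as ℕ
open import Data.Nat.Induction using (<-wellFounded)
open import Data.Product.Base using (Σ; ∃; ∃-syntax; _×_; _,_; proj₁; proj₂)
open import Data.Product using (∃!)
import Data.Product.Properties as Product
open import Data.Rational.Base using (ℚ; 0ℚ; _/_)
open import Data.Sum.Base using (_⊎_; inj₁; inj₂; swap; [_,_]′) renaming (map to map-⊎)
open import Data.Vec.Base as Vec using (Vec; []; _∷_; lookup; replicate; _[_]≔_)
import Data.Vec.Properties as Vec
open import Function.Base using (_∘_)
open import Induction.WellFounded using (Acc; acc)
open import Level using (Level; 0ℓ)
open import Relation.Binary.Core using (Rel)
open import Relation.Binary.Definitions using (Symmetric; Irreflexive; DecidableEquality)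
import Relation.Binary.Definitions as Binary
open import Relation.Binary.PropositionalEquality
  using (_≡_; _≢_; refl; sym; trans; cong; subst)
open import Relation.Nullary.Decidable
  using (Dec; yes; no; ¬?; _×-dec_; _⊎-dec_; _→-dec_; map′; decidable-stable; dec⇒maybe)
open import Relation.Nullary.Negation using (¬_; contradiction)
open import Relation.Unary using (Pred; Decidable)

private
  variable
    a p : Level

------------------------------------------------------------------------
-- Finite simple graphs

record Graph (n : ℕ) : Set₁ where
  field
    Adj    : Rel (Fin n) 0ℓ
    adj?   : Binary.Decidable Adj
    symm   : Symmetric Adj
    irrefl : Irreflexive _≡_ Adj

infixr 6 _∪_

_∪_ : ∀ {n} → Graph n → Graph n → Graph n
G ∪ H = record
  { Adj    = λ u v → G.Adj u v ⊎ H.Adj u v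
  ; adj?   = λ u v → G.adj? u v ⊎-dec H.adj? u v
  ; symm   = map-⊎ G.symm H.symm
  ; irrefl = λ u≡v → [ G.irrefl u≡v , H.irrefl u≡v ]′
  }
  where
  module G = Graph G
  module H = Graph H

Follows : ∀ {n} → Fin n → Fin n → Set
Follows {n} u v = (toℕ v ≡ suc (toℕ u)) ⊎ (suc (toℕ u) ≡ n × toℕ v ≡ 0)

-- The Hamiltonian cycle 0, 1, …, n - 1, 0.  The condition u ≢ v only matters
-- for n = 1, where it removes a loop.
cycle : ∀ n → Graph n
cycle n = record
  { Adj    = λ u v → u ≢ v × (Follows u v ⊎ Follows v u)
  ; adj?   = λ u v → ¬? (u Fin.≟ v) ×-dec (follows? u v ⊎-dec follows? v u)
  ; symm   = λ (u≢v , f) → u≢v ∘ sym , swap f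
  ; irrefl = λ u≡v (u≢v , _) → u≢v u≡v
  }
  where
  follows? : Binary.Decidable (Follows {n})
  follows? u v = (toℕ v ℕ.≟ suc (toℕ u)) ⊎-dec ((suc (toℕ u) ℕ.≟ n) ×-dec (toℕ v ℕ.≟ 0))

------------------------------------------------------------------------
-- Perfect matchings of the complete graph

vecs : {A : Set a} → List A → ∀ n → List (Vec A n)
vecs xs zero    = [] ∷ []
vecs xs (suc n) = cartesianProductWith _∷_ xs (vecs xs n)

∈-vecs : {A : Set a} {xs : List A} → (∀ x → x ∈ xs) → ∀ {n} (v : Vec A n) → v ∈ vecs xs n
∈-vecs all []      = here refl
∈-vecs all (x ∷ v) = ∈-cartesianProductWith⁺ _∷_ (all x) (∈-vecs all v)

Matrix : ℕ → Set
Matrix n = Vec (Vec Bool n) n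

Joined : ∀ {n} → Matrix n → Fin n → Fin n → Set
Joined A u v = T (lookup (lookup A u) v)

-- A set of edges of the complete graph, given by its adjacency matrix, such
-- that every vertex lies on exactly one of the edges.
IsPerfectMatching : ∀ {n} → Matrix n → Set
IsPerfectMatching A =
    (∀ u v → Joined A u v → Joined A v u)
  × (∀ u → ¬ Joined A u u)
  × (∀ u → ∃! _≡_ (Joined A u))

isPerfectMatching? : ∀ {n} → Decidable (IsPerfectMatching {n})
isPerfectMatching? A =
        all? (λ u → all? λ v → joined? u v →-dec joined? v u)
  ×-dec all? (λ u → ¬? (joined? u u))
  ×-dec all? (λ u → any? λ v → joined? u v ×-dec
          map′ (λ f {w} → f w) (λ f w → f {w}) (all? λ w → joined? u w →-dec (v Fin.≟ w)))
  where
  joined? : Binary.Decidable (Joined A)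
  joined? u v = T? _

PerfectMatching : ℕ → Set
PerfectMatching n = Σ (Matrix n) IsPerfectMatching

toGraph : ∀ {n} → PerfectMatching n → Graph n
toGraph (A , symm , irrefl , _) = record
  { Adj    = Joined A
  ; adj?   = λ u v → T? _
  ; symm   = λ {u} {v} → symm u v
  ; irrefl = λ { {u} refl → irrefl u }
  }

-- Every perfect matching on n vertices, listed once.
perfectMatchings : ∀ n → List (PerfectMatching n)
perfectMatchings n =
  mapMaybe (λ A → Maybe.map (A ,_) (dec⇒maybe (isPerfectMatching? A)))
           (vecs (vecs (true ∷ false ∷ []) n) n)

------------------------------------------------------------------------
-- Uniform probability on the entries of a list

fromℕ : ℕ → ℚ
fromℕ m = + m / 1

-- The value 0 on the empty list is a convention.
Pr : {A : Set a} {P : Pred A p} → List A → Decidable P → ℚ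
Pr []          P? = 0ℚ
Pr xs@(_ ∷ ys) P? = + length (filter P? xs) / suc (length ys)

------------------------------------------------------------------------
-- The entanglement game on G with k cops

module Game {n : ℕ} (G : Graph n) (k : ℕ) where
  open Graph G using (Adj; adj?)

  -- The position of each cop; nothing means that the cop is off the graph.
  Cops : Set
  Cops = Vec (Maybe (Fin n)) k

  outside : Cops
  outside = replicate k nothing

  Occupied : Cops → Fin n → Set
  Occupied C v = ∃[ i ] lookup C i ≡ just v

  -- The cops stay (nothing), or cop i flies to the robber (just i).
  Move : Set
  Move = Maybe (Fin k)

  move : Move → Fin n → Cops → Cops
  move nothing  v C = C
  move (just i) v C = C [ i ]≔ just v

  -- The first argument lists the previous positions of the robber, latest
  -- first; the second is his current position.  Together with the strategy
  -- they determine all previous moves of the cops.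
  Strategy : Set
  Strategy = List (Fin n) → Fin n → Move

  -- r t is the position of the robber at the start of turn t.
  past : (ℕ → Fin n) → ℕ → List (Fin n)
  past r zero    = []
  past r (suc t) = r t ∷ past r t

  -- The cops at the start of turn t.
  cops : Strategy → (ℕ → Fin n) → ℕ → Cops
  cops σ r zero    = outside
  cops σ r (suc t) = move (σ (past r t) (r t)) (r t) (cops σ r t)

  -- r is an infinite play against σ.
  Evades : Strategy → (ℕ → Fin n) → Set
  Evades σ r = ∀ t → Adj (r t) (r (suc t)) × ¬ Occupied (cops σ r (suc t)) (r (suc t))

  Winning : Strategy → Set
  Winning σ = ∀ r → ¬ Evades σ r

  CopsWin : Set
  CopsWin = ∃ Winning

  ----------------------------------------------------------------------
  -- Decidability of CopsWin

  State : Set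
  State = Cops × Fin n

  Option : Cops → Fin n → Fin n → Set
  Option C v w = Adj v w × ¬ Occupied C w

  data Won : State → Set where
    win : ∀ {C v} m →
          (∀ w → Option (move m v C) v w → Won (move m v C , w)) →
          Won (C , v)

  private
    _≟ₚ_ : DecidableEquality (Maybe (Fin n))
    _≟ₚ_ = Maybe.≡-dec Fin._≟_

    _≟ₛ_ : DecidableEquality State
    _≟ₛ_ = Product.≡-dec (Vec.≡-dec _≟ₚ_) Fin._≟_

    open DecMembership _≟ₛ_ using (_∈?_; _∉?_)

    option? : ∀ C v w → Dec (Option C v w)
    option? C v w = adj? v w ×-dec ¬? (any? λ i → lookup C i ≟ₚ just w)

    anyMove? : {P : Pred Move p} → Decidable P → Dec (∃ P)
    anyMove? {P = P} P? =
      map′ [ (nothing ,_) , (λ (i , q) → just i , q) ]′ back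
           (P? nothing ⊎-dec any? (P? ∘ just))
      where
      back : ∃ P → P nothing ⊎ ∃ (P ∘ just)
      back (nothing , q) = inj₁ q
      back (just i  , q) = inj₂ (i , q)

    -- From the state the cops can reach the complement of U in one turn.
    Leaves : List State → State → Set
    Leaves U (C , v) = ∃[ m ] ∀ w → Option (move m v C) v w → (move m v C , w) ∉ U

    leaves? : ∀ U → Decidable (Leaves U)
    leaves? U (C , v) = anyMove? λ m →
      all? λ w → option? (move m v C) v w →-dec ((move m v C , w) ∉? U)

    trapped : ∀ U → (∀ s → s ∈ U → ¬ Leaves U s) → ∀ {s} → s ∈ U → ¬ Won s
    trapped U closed s∈U (win m f) =
      closed _ s∈U (m , λ w o w∈U → trapped U closed w∈U (f w o))

    -- U lists the states not yet known to be won.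
    decideFrom : ∀ U → Acc ℕ._<_ (length U) → (∀ s → s ∉ U → Won s) → Decidable Won
    decideFrom U (acc rec) won s with Any.any? (leaves? U) U
    ... | yes any = decideFrom U′ (rec smaller) won′ s
      where
      u = proj₁ (find any)
      u∈U = proj₁ (proj₂ (find any))
      leaves = proj₂ (proj₂ (find any))

      ≢u? : ∀ x → Dec (x ≢ u)
      ≢u? x = ¬? (x ≟ₛ u)

      U′ = filter ≢u? U

      smaller : length U′ ℕ.< length U
      smaller = filter-notAll ≢u? U (Any.map (λ u≡x x≢u → x≢u (sym u≡x)) u∈U)

      won′ : ∀ x → x ∉ U′ → Won x
      won′ x x∉U′ with x ≟ₛ u
      ... | yes refl = win (proj₁ leaves) λ w o → won _ (proj₂ leaves w o)
      ... | no  x≢u  = won x λ x∈U → x∉U′ (∈-filter⁺ ≢u? x∈U x≢u)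
    ... | no none with s ∈? U
    ...   | yes s∈U = no (trapped U (λ x x∈U l → none (lose x∈U l)) s∈U)
    ...   | no  s∉U = yes (won s s∉U)

    states : List State
    states = cartesianProduct (vecs (nothing ∷ List.map just (allFin n)) k) (allFin n)

    ∈-states : ∀ s → s ∈ states
    ∈-states (C , v) = ∈-cartesianProduct⁺ (∈-vecs position C) (∈-allFin v)
      where
      position : ∀ x → x ∈ (nothing ∷ List.map just (allFin n))
      position nothing  = here refl
      position (just v) = there (∈-map⁺ just (∈-allFin v))

  won? : Decidable Won
  won? = decideFrom states (<-wellFounded _) (λ s s∉ → contradiction (∈-states s) s∉)

  won⇒copsWin : (∀ v → Won (outside , v)) → CopsWin
  won⇒copsWin start = σ , λ r e → noPlay r e 0 (start (r 0)) refl refl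
    where
    Position : Fin n → Set
    Position v = Maybe (∃[ C ] Won (C , v))

    advance : ∀ {v} → Position v → ∀ w → Position w
    advance nothing w = nothing
    advance {v} (just (C , win m f)) w with option? (move m v C) v w
    ... | yes o = just (move m v C , f w o)
    ... | no  _ = nothing

    follow : List (Fin n) → ∀ v → Position v
    follow []      v = just (outside , start v)
    follow (u ∷ h) v = advance (follow h u) v

    choice : ∀ {v} → Position v → Move
    choice nothing                = nothing
    choice (just (C , win m f)) = m

    σ : Strategy
    σ h v = choice (follow h v)

    noPlay : ∀ r → Evades σ r → ∀ t {C} (W : Won (C , r t)) →
             follow (past r t) (r t) ≡ just (C , W) → ¬ cops σ r t ≡ C
    noPlay r e t {C} (win m f) eq refl = go (e t)
      where
      C′ : Cops
      C′ = move m (r t) C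

      copsEq : cops σ r (suc t) ≡ C′
      copsEq = cong (λ x → move (choice x) (r t) C) eq

      go : Option (cops σ r (suc t)) (r t) (r (suc t)) → _
      go (a , free) with option? C′ (r t) (r (suc t)) in eq′
      ... | no ¬o = ¬o (a , free ∘ subst (λ D → Occupied D (r (suc t))) (sym copsEq))
      ... | yes o = noPlay r e (suc t) (f (r (suc t)) o) eq″ copsEq
        where
        eq″ : follow (past r (suc t)) (r (suc t)) ≡ just (C′ , f (r (suc t)) o)
        eq″ rewrite eq | eq′ = refl

  copsWin⇒won : CopsWin → ∀ v → Won (outside , v)
  copsWin⇒won (σ , winning) v₀ = decidable-stable (won? _) λ ¬W → winning (r ¬W) (evades ¬W)
    where
    escape : ∀ {C v} → ¬ Won (C , v) → ∀ m →
             ∃[ w ] Option (move m v C) v w × ¬ Won (move m v C , w)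
    escape {C} {v} ¬W m with
      ¬∀⟶∃¬ n _ (λ w → option? (move m v C) v w →-dec won? (move m v C , w)) (¬W ∘ win m)
    ... | w , ¬f = w
                 , decidable-stable (option? (move m v C) v w) (λ ¬o → ¬f λ o → contradiction o ¬o)
                 , λ W → ¬f λ _ → W

    record Stage : Set where
      constructor stage
      field
        history : List (Fin n)
        {C}     : Cops
        {v}     : Fin n
        ¬won    : ¬ Won (C , v)
    open Stage

    next : Stage → Stage
    next S = stage (v S ∷ history S) (proj₂ (proj₂ (escape (¬won S) (σ (history S) (v S)))))

    module _ (¬W : ¬ Won (outside , v₀)) where
      run : ℕ → Stage
      run zero    = stage [] ¬W
      run (suc t) = next (run t)

      r : ℕ → Fin n
      r = v ∘ run

      past≡ : ∀ t → past r t ≡ history (run t)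
      past≡ zero    = refl
      past≡ (suc t) = cong (r t ∷_) (past≡ t)

      cops≡ : ∀ t → cops σ r t ≡ C (run t)
      cops≡ zero = refl
      cops≡ (suc t) rewrite past≡ t | cops≡ t = refl

      evades : Evades σ r
      evades t rewrite cops≡ (suc t) =
        proj₁ (proj₂ (escape (¬won (run t)) (σ (history (run t)) (r t))))

  copsWin? : Dec CopsWin
  copsWin? = map′ won⇒copsWin copsWin⇒won (all? λ v → won? (outside , v))

open Game using (CopsWin; copsWin?) public

------------------------------------------------------------------------
-- The entanglement number

-- Cop v flies to the robber when he is at v, so that the robber can never
-- return to a vertex.
enoughCops : ∀ {n} (G : Graph n) → CopsWin G n
enoughCops {n} G = σ , λ r e →
  let i , j , i<j , eq = pigeonhole (ℕ.n<1+n n) (r ∘ toℕ)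
  in  noReturn r e (toℕ i) (toℕ j) i<j eq
  where
  open Game G n

  σ : Strategy
  σ _ v = just v

  visited : ∀ r s t → s ℕ.< t → lookup (cops σ r t) (r s) ≡ just (r s)
  visited r s (suc t) (s≤s s≤t) with r s Fin.≟ r t
  ... | yes eq rewrite eq = Vec.lookup∘update (r t) (cops σ r t) (just (r t))
  ... | no  neq = trans (Vec.lookup∘update′ neq (cops σ r t) (just (r t)))
                        (visited r s t (ℕ.≤∧≢⇒< s≤t λ { refl → neq refl }))

  noReturn : ∀ r → Evades σ r → ∀ s t → s ℕ.< t → r s ≢ r t
  noReturn r e s (suc t) s<t eq =
    proj₂ (e t) (r s , trans (visited r s (suc t) s<t) (cong just eq))

Least : Pred ℕ p → Pred ℕ p
Least P k = P k × (∀ j → P j → k ℕ.≤ j)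

least : {P : Pred ℕ p} → Decidable P → ∀ n → P n → ∃ (Least P)
least P? zero    pn = zero , pn , λ _ _ → z≤n
least {P = P} P? (suc n) pn with P? zero
... | yes p0 = zero , p0 , λ _ _ → z≤n
... | no ¬p0 with least (P? ∘ suc) n pn
...   | k , pk , min = suc k , pk , min′
  where
  min′ : ∀ j → P j → suc k ℕ.≤ j
  min′ zero    p0 = contradiction p0 ¬p0
  min′ (suc j) pj = s≤s (min j pj)

entanglement : ∀ {n} (G : Graph n) → ∃ (Least (CopsWin G))
entanglement {n} G = least (copsWin? G) n (enoughCops G)

ent : ∀ {n} → Graph n → ℕ
ent G = proj₁ (entanglement G)

ent-least : ∀ {n} (G : Graph n) → Least (CopsWin G) (ent G)
ent-least G = proj₂ (entanglement G)

{-# OPTIONS --safe #-}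

-- The robber survives as long as no set of at most k vertices (the cops) cuts off a union of components
-- with between a and 2a vertices: he avoids the vertices lying in a small cut-off union, because a union
-- of two small ones has at most 2a vertices and is therefore small again.
--
-- A forbidden union with k ≤ t is a colouring left / right / cut of the vertices with at most t cut
-- vertices and no edge between left and right.  The edges of the Hamiltonian path alone leave only
-- 2 ((q + 2) / q)ⁿ qᵗ colourings, for every q.  For each of them the matching has no edge between left and
-- right with probability at most (65 / 72)^σ, where σ is proportional to n: the partners of σ left vertices
-- are considered one after the other, and each has a constant chance to be right.  For t = n / D with a
-- large constant D the product of the two bounds decays exponentially.

module Submission where

open import Defs
open import Data.Bool.Base using (true; false; T)
open import Data.Fin.Base using (Fin; zero; suc; toℕ)
open import Data.Fin.Permutation.Components using (transpose; transpose-inverse)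
import Data.Fin.Properties as Fin
open import Data.Integer.Base as ℤ using (+[1+_]) renaming (+_ to pos)
import Data.Integer.Properties as ℤ
import Data.Integer.Tactic.RingSolver as ℤSolver
open import Data.List.Base as List
  using (List; []; _∷_; _++_; length; filter; map; mapMaybe; take; drop; cartesianProduct; allFin; tabulate)
open import Data.List.Membership.Propositional using (_∈_; _∉_; find; lose)
open import Data.List.Membership.Propositional.Properties
  using (∈-allFin; ∈-∃++; ∈-map⁺; ∈-++⁻; ∈-++⁺ˡ; ∈-++⁺ʳ; ∈-filter⁻; ∈-filter⁺;
         ∈-cartesianProduct⁺; ∈-cartesianProduct⁻)
import Data.List.Properties as List
open import Data.List.Relation.Unary.All as All using (All; []; _∷_)
import Data.List.Relation.Unary.All.Properties as All
open import Data.List.Relation.Unary.AllPairs using ([]; _∷_)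
open import Data.List.Relation.Unary.Any as Any using (Any; here; there)
open import Data.List.Relation.Unary.Unique.Propositional using (Unique)
import Data.List.Relation.Unary.Unique.Propositional.Properties as Unique
open import Data.Maybe.Base as Maybe using (just; nothing)
import Data.Maybe.Properties as Maybe
open import Data.Nat.Base
  using (ℕ; zero; suc; _+_; _*_; _^_; _∸_; _≤_; _<_; z≤n; s≤s; NonZero; >-nonZero; >-nonZero⁻¹)
open import Data.Nat.Divisibility using (_∣_; divides)
open import Data.Nat.DivMod using (_/_; _%_; m≡m%n+[m/n]*n; m%n<n; m*n/n≡m; /-monoˡ-≤)
import Data.Nat.Properties as ℕ
open import Data.Nat.Tactic.RingSolver using (solve-∀)
open import Data.Product.Base using (∃-syntax; _×_; _,_; proj₁; proj₂)
open import Data.Rational.Base as ℚ using (ℚ; mkℚ; 0ℚ; 1ℚ; ↧ₙ_)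
import Data.Rational.Properties as ℚ
import Data.Rational.Unnormalised.Base as ℚᵘ
import Data.Rational.Unnormalised.Properties as ℚᵘ
open import Data.Sum.Base as Sum using (_⊎_; inj₁; inj₂; [_,_]′)
open import Data.Vec.Base as Vec using (Vec; []; _∷_; lookup)
import Data.Vec.Properties as Vec
open import Function.Base using (_∘_; id)
open import Level using (Level)
open import Relation.Binary.Definitions using (DecidableEquality)
open import Relation.Binary.PropositionalEquality
  using (_≡_; _≢_; refl; sym; trans; cong; cong₂; subst; subst₂)
open import Relation.Nullary.Decidable
  using (Dec; yes; no; T?; ¬?; _×-dec_; _→-dec_; isYes; toSum; toWitness; fromWitness; dec⇒maybe; dec-true;
         dec-false; decidable-stable)
open import Relation.Nullary.Negation using (¬_; contradiction)
open import Relation.Unary using (Pred; Decidable; ∅; U)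
open import Relation.Unary.Properties using (U?)

private
  variable
    ℓ ℓ′ ℓ₁ ℓ₂ ℓ₃ : Level
    A : Set ℓ
    B : Set ℓ′
    n : ℕ

-- Counting

count : {P : Pred A ℓ₁} → Decidable P → List A → ℕ
count P? xs = length (filter P? xs)

module _ {P : Pred A ℓ₁} {Q : Pred A ℓ₂} (P? : Decidable P) (Q? : Decidable Q) where

  count-mono : ∀ xs → (∀ {x} → x ∈ xs → P x → Q x) → count P? xs ≤ count Q? xs
  count-mono [] f = z≤n
  count-mono (x ∷ xs) f with ih ← count-mono xs (f ∘ there) | P? x | Q? x
  ... | no _   | no _   = ih
  ... | no _   | yes _  = ℕ.m≤n⇒m≤1+n ih
  ... | yes px | no ¬qx = contradiction (f (here refl) px) ¬qx
  ... | yes _  | yes _  = s≤s ih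

  module _ {R : Pred A ℓ₃} (R? : Decidable R) where

    count-∪ : ∀ xs → (∀ {x} → x ∈ xs → P x → Q x ⊎ R x) →
              count P? xs ≤ count Q? xs + count R? xs
    count-∪ [] f = z≤n
    count-∪ (x ∷ xs) f with ih ← count-∪ xs (f ∘ there) | P? x | Q? x | R? x
    ... | no _   | no _  | no _  = ih
    ... | no _   | no _  | yes _ = ℕ.≤-trans ih (ℕ.+-monoʳ-≤ _ (ℕ.n≤1+n _))
    ... | no _   | yes _ | no _  = ℕ.m≤n⇒m≤1+n ih
    ... | no _   | yes _ | yes _ = ℕ.m≤n⇒m≤1+n (ℕ.≤-trans ih (ℕ.+-monoʳ-≤ _ (ℕ.n≤1+n _)))
    ... | yes px | no ¬q | no ¬r = contradiction (f (here refl) px) [ ¬q , ¬r ]′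
    ... | yes _  | no _  | yes _ = ℕ.≤-trans (s≤s ih) (ℕ.≤-reflexive (sym (ℕ.+-suc _ _)))
    ... | yes _  | yes _ | no _  = s≤s ih
    ... | yes _  | yes _ | yes _ = s≤s (ℕ.≤-trans ih (ℕ.+-monoʳ-≤ _ (ℕ.n≤1+n _)))

    count-⊎ : ∀ xs → (∀ {x} → P x → R x) → (∀ {x} → Q x → R x) → (∀ {x} → P x → ¬ Q x) →
              count P? xs + count Q? xs ≤ count R? xs
    count-⊎ [] f g d = z≤n
    count-⊎ (x ∷ xs) f g d with ih ← count-⊎ xs f g d | P? x | Q? x | R? x
    ... | no _   | no _   | no _  = ih
    ... | no _   | no _   | yes _ = ℕ.m≤n⇒m≤1+n ih
    ... | no _   | yes qx | no ¬r = contradiction (g qx) ¬r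
    ... | no _   | yes _  | yes _ = ℕ.≤-trans (ℕ.≤-reflexive (ℕ.+-suc _ _)) (s≤s ih)
    ... | yes px | no _   | no ¬r = contradiction (f px) ¬r
    ... | yes _  | no _   | yes _ = s≤s ih
    ... | yes px | yes qx | _     = contradiction qx (d px)

count-all : {P : Pred A ℓ₁} (P? : Decidable P) → (∀ x → P x) → ∀ xs → count P? xs ≡ length xs
count-all P? f xs = cong length (List.filter-all P? (All.universal f xs))

count-map : {P : Pred B ℓ₁} (P? : Decidable P) (f : A → B) → ∀ xs →
            count P? (map f xs) ≡ count (P? ∘ f) xs
count-map P? f [] = refl
count-map P? f (x ∷ xs) with P? (f x)
... | yes _ = cong suc (count-map P? f xs)
... | no  _ = count-map P? f xs

-- A relation stands in for an injection, because images are found only with the help of `x ∈ xs`.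
-- The image of the head is cut out of `ys`, and by injectivity no later element is sent to it.
length-injective-≤ : (R : A → B → Set ℓ₃) → ∀ {xs ys} → Unique xs →
                     (∀ {x} → x ∈ xs → ∃[ y ] y ∈ ys × R x y) →
                     (∀ {x x′ y} → x ∈ xs → x′ ∈ xs → R x y → R x′ y → x ≡ x′) →
                     length xs ≤ length ys
length-injective-≤ R [] total inj = z≤n
length-injective-≤ {A = A} R {x ∷ xs} {ys} (x∉xs ∷ unique) total inj
  with total (here refl)
... | y , y∈ys , Rxy with ∈-∃++ y∈ys
... | us , vs , refl = ℕ.≤-trans (s≤s ih) (ℕ.≤-reflexive (sym (List.length-++-sucʳ us y vs)))
  where
  total′ : ∀ {x′} → x′ ∈ xs → ∃[ y′ ] y′ ∈ us ++ vs × R x′ y′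
  total′ x′∈xs with total (there x′∈xs)
  ... | y′ , y′∈ys , Rx′y′ with ∈-++⁻ us y′∈ys
  ... | inj₁ y′∈us = y′ , ∈-++⁺ˡ y′∈us , Rx′y′
  ... | inj₂ (there y′∈vs) = y′ , ∈-++⁺ʳ us y′∈vs , Rx′y′
  ... | inj₂ (here refl) =
    contradiction (inj (here refl) (there x′∈xs) Rxy Rx′y′) (All.lookup x∉xs x′∈xs)
  ih : length xs ≤ length (us ++ vs)
  ih = length-injective-≤ R unique total′ λ x∈ x′∈ → inj (there x∈) (there x′∈)

-- Two-sided colourings

data Side : Set where
  left right cut : Side

_≟_ : DecidableEquality Side
left  ≟ left  = yes refl
left  ≟ right = no λ ()
left  ≟ cut   = no λ ()
right ≟ left  = no λ ()
right ≟ right = yes refl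
right ≟ cut   = no λ ()
cut   ≟ left  = no λ ()
cut   ≟ right = no λ ()
cut   ≟ cut   = yes refl

size : ∀ {n} → (Fin n → Side) → Side → ℕ
size {n} f c = count (λ v → f v ≟ c) (allFin n)

Separates : ∀ {n} → (Fin n → Side) → (Fin n → Fin n → Set) → Set
Separates f E = ∀ u v → E u v → f u ≡ left → f v ≢ right

-- The left vertices form a union of components of the graph without the cut vertices.  No such union
-- has between a and 2a vertices.
Unsplittable : ∀ {n} → Graph n → ℕ → ℕ → Set
Unsplittable {n} G k a = ∀ (f : Fin n → Side) → Separates f (Graph.Adj G) →
  size f cut ≤ k → size f left ≤ 2 * a → size f left < a

-- The robber's escape in an unsplittable graph

module _ {n k a : ℕ} (G : Graph n) (unsplittable : Unsplittable G k a) (0<a : 0 < a) where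
  open Graph G
  open Game G k using (Cops; Occupied; Option; Won; win; move; outside)

  -- Fewer than a vertices, among them all those in P, are cut off from the rest by the cops.
  record Small (C : Cops) (P : Fin n → Set) : Set where
    field
      side : Fin n → Side
      separates : Separates side Adj
      cut⇒occupied : ∀ v → side v ≡ cut → Occupied C v
      small : size side left < a
      covers : ∀ v → P v → side v ≡ left

  -- Each cut vertex is charged to a cop standing on it, and a cop stands on at most one vertex.
  cut-small : ∀ (C : Cops) (f : Fin n → Side) → (∀ v → f v ≡ cut → Occupied C v) → size f cut ≤ k
  cut-small C f occ = ℕ.≤-trans
    (length-injective-≤ (λ v i → lookup C i ≡ just v)
      (Unique.filter⁺ (λ v → f v ≟ cut) (Unique.allFin⁺ n))
      (λ v∈ → let i , eq = occ _ (proj₂ (∈-filter⁻ (λ v → f v ≟ cut) {xs = allFin n} v∈))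
               in i , ∈-allFin i , eq)
      (λ _ _ eq eq′ → Maybe.just-injective (trans (sym eq) eq′)))
    (ℕ.≤-reflexive (List.length-tabulate id))

  -- Left takes precedence over cut, and cut over right. So right means right in both colourings,
  -- and an edge from left to right would already violate one of them.
  _∪ₛ_ : Side → Side → Side
  left  ∪ₛ _    = left
  right ∪ₛ y    = y
  cut   ∪ₛ left = left
  cut   ∪ₛ _    = cut

  union-left⁻ : ∀ x y → x ∪ₛ y ≡ left → x ≡ left ⊎ y ≡ left
  union-left⁻ left  y    eq = inj₁ refl
  union-left⁻ right y    eq = inj₂ eq
  union-left⁻ cut   left eq = inj₂ refl

  union-right⁻ : ∀ x y → x ∪ₛ y ≡ right → x ≡ right × y ≡ right
  union-right⁻ right y     eq = refl , eq
  union-right⁻ cut   left  ()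
  union-right⁻ cut   right ()
  union-right⁻ cut   cut   ()

  union-cut⁻ : ∀ x y → x ∪ₛ y ≡ cut → x ≡ cut ⊎ y ≡ cut
  union-cut⁻ right y   eq = inj₂ eq
  union-cut⁻ cut   y   eq = inj₁ refl

  union-left⁺ʳ : ∀ x {y} → y ≡ left → x ∪ₛ y ≡ left
  union-left⁺ʳ left  refl = refl
  union-left⁺ʳ right refl = refl
  union-left⁺ʳ cut   refl = refl

  -- The union has at most 2a left vertices, hence fewer than a.
  small-∪ : ∀ {C P Q} → Small C P → Small C Q → Small C (λ v → P v ⊎ Q v)
  small-∪ {C} {P} {Q} S T = record
    { side = f
    ; separates = separates
    ; cut⇒occupied = occ
    ; small = unsplittable f separates (cut-small C f occ) size≤
    ; covers = λ { v (inj₁ pv) → cong (_∪ₛ T.side v) (S.covers v pv)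
                 ; v (inj₂ qv) → union-left⁺ʳ (S.side v) (T.covers v qv) }
    }
    where
    module S = Small S
    module T = Small T
    f : Fin n → Side
    f v = S.side v ∪ₛ T.side v
    separates : Separates f Adj
    separates u v uv l r with union-left⁻ _ _ l | union-right⁻ (S.side v) _ r
    ... | inj₁ l′ | r′ , _ = S.separates u v uv l′ r′
    ... | inj₂ l′ | _ , r′ = T.separates u v uv l′ r′
    occ : ∀ v → f v ≡ cut → Occupied C v
    occ v c = [ S.cut⇒occupied v , T.cut⇒occupied v ]′ (union-cut⁻ _ _ c)
    size≤ : size f left ≤ 2 * a
    size≤ = begin
      size f left                           ≤⟨ count-∪ (λ v → f v ≟ left) (λ v → S.side v ≟ left)
                                                (λ v → T.side v ≟ left) (allFin n)
                                                (λ {v} _ → union-left⁻ (S.side v) _) ⟩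
      size S.side left + size T.side left   ≤⟨ ℕ.+-mono-≤ (ℕ.<⇒≤ S.small) (ℕ.<⇒≤ T.small) ⟩
      a + a                                 ≡⟨ cong (a +_) (ℕ.+-identityʳ a) ⟨
      2 * a                                 ∎
      where open ℕ.≤-Reasoning

  small-mono : ∀ {C P Q} → (∀ v → Q v → P v) → Small C P → Small C Q
  small-mono f S = record { Small S ; covers = λ v → Small.covers S v ∘ f v }

  small-∅ : ∀ {C} → Small C ∅
  small-∅ = record
    { side = λ _ → right
    ; separates = λ _ _ _ ()
    ; cut⇒occupied = λ _ ()
    ; small = ℕ.≤-trans (s≤s (ℕ.≤-reflexive (cong length (List.filter-none (λ _ → right ≟ left)
                (All.universal (λ _ ()) (allFin n)))))) 0<a
    ; covers = λ _ ()
    }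

  -- However many vertices `P` has, the bound `a` survives, because every application of `small-∪`
  -- brings the size back below `a`.
  small-cover : ∀ {C} {P : Fin n → Set} → Decidable P → (∀ v → P v → Small C (_≡ v)) → Small C P
  small-cover {C} {P} P? f = small-mono (λ v pv → ∈-allFin v , pv) (go (allFin n))
    where
    go : ∀ vs → Small C (λ v → v ∈ vs × P v)
    go [] = small-mono (λ _ ()) small-∅
    go (v ∷ vs) with P? v
    ... | yes pv = small-mono (λ { _ (here eq , _) → inj₁ eq ; _ (there v∈ , pv) → inj₂ (v∈ , pv) })
                     (small-∪ (f v pv) (go vs))
    ... | no ¬pv = small-mono (λ { _ (here refl , pv) → contradiction pv ¬pv
                             ; _ (there v∈ , pv) → v∈ , pv })
                     (go vs)

  occupied? : ∀ C v → Dec (Occupied C v)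
  occupied? C v = Fin.any? λ i → Maybe.≡-dec Fin._≟_ (lookup C i) (just v)

  option? : ∀ C v w → Dec (Option C v w)
  option? C v w = adj? v w ×-dec ¬? (occupied? C w)

  move-occupied : ∀ m v C {w} → Occupied (move m v C) w → Occupied C w ⊎ w ≡ v
  move-occupied nothing v C occ = inj₁ occ
  move-occupied (just i) v C (j , eq) with j Fin.≟ i
  ... | yes refl = inj₂ (Maybe.just-injective (trans (sym eq) (Vec.lookup∘update i C (just v))))
  ... | no j≢i  = inj₁ (j , trans (sym (Vec.lookup∘update′ j≢i C (just v))) eq)

  -- If all options of the robber at v are small, then v joins them, and the vertices occupied before
  -- the move become cut.
  stepBack : ∀ m {C v} → Small (move m v C) (Option (move m v C) v) → Small C (_≡ v)
  stepBack m {C} {v} S = record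
    { side = f
    ; separates = separates
    ; cut⇒occupied = occ
    ; small = unsplittable f separates (cut-small C f occ) size≤
    ; covers = λ { _ refl → f-v }
    }
    where
    module S = Small S
    f : Fin n → Side
    f x with x Fin.≟ v | occupied? C x
    ... | yes _ | _     = left
    ... | no  _ | yes _ = cut
    ... | no  _ | no  _ = S.side x
    f-v : f v ≡ left
    f-v with v Fin.≟ v
    ... | yes _  = refl
    ... | no v≢v = contradiction refl v≢v
    left⁻ : ∀ x → f x ≡ left → S.side x ≡ left ⊎ x ≡ v
    left⁻ x l with x Fin.≟ v | occupied? C x
    left⁻ x l | yes eq | _     = inj₂ eq
    left⁻ x () | no  _ | yes _
    left⁻ x l | no  _ | no  _ = inj₁ l
    right⁻ : ∀ x → f x ≡ right → x ≢ v × ¬ Occupied C x × S.side x ≡ right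
    right⁻ x r with x Fin.≟ v | occupied? C x
    right⁻ x () | yes _   | _
    right⁻ x () | no  _   | yes _
    right⁻ x r  | no  x≢v | no free = x≢v , free , r
    occ : ∀ x → f x ≡ cut → Occupied C x
    occ x c with x Fin.≟ v | occupied? C x
    occ x () | yes _   | _
    occ x c  | no  _   | yes o = o
    occ x c  | no  x≢v | no  _ with move-occupied m v C (S.cut⇒occupied x c)
    ... | inj₁ o   = o
    ... | inj₂ x≡v = contradiction x≡v x≢v
    separates : Separates f Adj
    separates u x ux l r with left⁻ u l | right⁻ x r
    ... | inj₁ l′   | _ , _ , r′ = S.separates u x ux l′ r′
    -- A right neighbour `x` of `v` is still free after the move, hence an option of the robber, and
    -- `S` colours all options left.
    ... | inj₂ refl | x≢v , free , r′ = contradiction (trans (sym (S.covers x (ux ,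
      [ free , x≢v ]′ ∘ move-occupied m v C))) r′) λ ()
    size≤ : size f left ≤ 2 * a
    size≤ = begin
      size f left                                             ≤⟨ count-∪ (λ x → f x ≟ left) (λ x → S.side x ≟ left) (Fin._≟ v)
                                                                  (allFin n) (λ {x} _ → left⁻ x) ⟩
      size S.side left + count (Fin._≟ v) (allFin n)          ≤⟨ ℕ.+-mono-≤ (ℕ.<⇒≤ S.small) single ⟩
      a + 1                                                   ≤⟨ ℕ.+-monoʳ-≤ a 0<a ⟩
      a + a                                                   ≡⟨ cong (a +_) (ℕ.+-identityʳ a) ⟨
      2 * a                                                   ∎
      where
      open ℕ.≤-Reasoning
      single : count (Fin._≟ v) (allFin n) ≤ 1
      single = length-injective-≤ (λ x y → x ≡ y) {ys = v ∷ []}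
        (Unique.filter⁺ (Fin._≟ v) (Unique.allFin⁺ n))
        (λ x∈ → v , here refl , proj₂ (∈-filter⁻ (Fin._≟ v) {xs = allFin n} x∈))
        (λ _ _ eq eq′ → trans eq (sym eq′))

  -- Induction on the cops' winning tree: after the winning move `m` all options of the robber are
  -- small, so they are small together, and `stepBack` passes this on to `v`.
  won⇒small : ∀ {C v} → Won (C , v) → Small C (_≡ v)
  won⇒small {C} {v} (win m f) =
    stepBack m (small-cover (option? (move m v C) v) λ w o → won⇒small (f w o))

  -- If the cops won, every starting vertex would be won and hence small with all cops outside. Then
  -- the union of all vertices would be small, although it has `n ≥ a` elements.
  ¬copsWin : a ≤ n → ¬ CopsWin G k
  ¬copsWin a≤n cops = ℕ.<-irrefl refl (ℕ.≤-trans (Small.small S) (ℕ.≤-trans a≤n n≤))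
    where
    S : Small outside U
    S = small-cover U? λ v _ → won⇒small (Game.copsWin⇒won G k cops v)
    n≤ : n ≤ size (Small.side S) left
    n≤ = ℕ.≤-reflexive (sym (trans (count-all _ (λ v → Small.covers S v _) (allFin n))
           (List.length-tabulate id)))

-- Colourings of a path

spend : ∀ {n} → (ℕ → List (Vec Side n)) → ℕ → List (Vec Side (suc n))
spend f zero    = []
spend f (suc s) = map (cut ∷_) (f s)

-- The colourings of a path on n vertices hanging from a vertex of colour c that have at most s cut
-- vertices and no edge between left and right.
walks : ∀ n → ℕ → Side → List (Vec Side n)
walks zero    s c     = [] ∷ []
walks (suc n) s left  = map (left ∷_) (walks n s left) ++ spend (λ t → walks n t cut) s
walks (suc n) s right = map (right ∷_) (walks n s right) ++ spend (λ t → walks n t cut) s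
walks (suc n) s cut   =
  map (left ∷_) (walks n s left) ++ (map (right ∷_) (walks n s right) ++ spend (λ t → walks n t cut) s)

Compatible : Side → Side → Set
Compatible c d = c ≢ cut → d ≢ cut → c ≡ d

size-suc : ∀ {n} (w : Vec Side n) d c →
           count (λ v → lookup (d ∷ w) v ≟ c) (tabulate suc) ≡ size (lookup w) c
size-suc {n} w d c = trans (cong (count (λ v → lookup (d ∷ w) v ≟ c)) (sym (List.map-tabulate id suc)))
                       (count-map (λ v → lookup (d ∷ w) v ≟ c) suc (allFin n))

size-∷ : ∀ {n} (w : Vec Side n) d c →
         size (lookup (d ∷ w)) c ≡ count (_≟ c) (d ∷ []) + size (lookup w) c
size-∷ {n} w d c with d ≟ c
... | yes _ = cong suc (size-suc w d c)
... | no  _ = size-suc w d c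

∈-walks : ∀ {n} (w : Vec Side n) s c →
          (∀ i j → toℕ j ≡ suc (toℕ i) → Compatible (lookup w i) (lookup w j)) →
          (∀ i → toℕ i ≡ 0 → Compatible c (lookup w i)) →
          size (lookup w) cut ≤ s → w ∈ walks n s c
∈-walks [] s c path first cuts = here refl
∈-walks {suc n} (d ∷ w) s c path first cuts =
  go d c (λ i eq → path zero (suc i) (cong suc eq)) (first zero refl)
    (subst (_≤ s) (size-∷ w d cut) cuts)
  where
  ih : ∀ s d → (∀ i → toℕ i ≡ 0 → Compatible d (lookup w i)) →
       size (lookup w) cut ≤ s → w ∈ walks n s d
  ih s d = ∈-walks w s d (λ i j eq → path (suc i) (suc j) (cong suc eq))

  spent : (∀ i → toℕ i ≡ 0 → Compatible cut (lookup w i)) → ∀ s → 1 + size (lookup w) cut ≤ s →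
          cut ∷ w ∈ spend (λ t → walks n t cut) s
  spent f (suc s) (s≤s cuts) = ∈-map⁺ _ (ih s cut f cuts)

  go : ∀ d c → (∀ i → toℕ i ≡ 0 → Compatible d (lookup w i)) → Compatible c d →
       count (_≟ cut) (d ∷ []) + size (lookup w) cut ≤ s → d ∷ w ∈ walks (suc n) s c
  go left  left  f cd l = ∈-++⁺ˡ (∈-map⁺ _ (ih s left f l))
  go left  right f cd l = contradiction (cd (λ ()) (λ ())) λ ()
  go left  cut   f cd l = ∈-++⁺ˡ (∈-map⁺ _ (ih s left f l))
  go right left  f cd l = contradiction (cd (λ ()) (λ ())) λ ()
  go right right f cd l = ∈-++⁺ˡ (∈-map⁺ _ (ih s right f l))
  go right cut   f cd l = ∈-++⁺ʳ (map (left ∷_) (walks n s left)) (∈-++⁺ˡ (∈-map⁺ _ (ih s right f l)))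
  go cut   left  f cd l = ∈-++⁺ʳ (map (left ∷_) (walks n s left)) (spent f s l)
  go cut   right f cd l = ∈-++⁺ʳ (map (right ∷_) (walks n s right)) (spent f s l)
  go cut   cut   f cd l =
    ∈-++⁺ʳ (map (left ∷_) (walks n s left)) (∈-++⁺ʳ (map (right ∷_) (walks n s right)) (spent f s l))

module _ (q : ℕ) .{{_ : NonZero q}} where
  open ℕ.≤-Reasoning

  private
    -- With `q ^ n` as a factor on the other side this stands for ((q + 2) / q) ^ n * q ^ s. A large
    -- `q` makes each vertex cheap and each cut vertex expensive.
    bound : ℕ → ℕ → ℕ
    bound n s = (q + 2) ^ n * q ^ s

  length-spend : ∀ {n} (f : ℕ → List (Vec Side n)) →
                 (∀ s → q ^ n * length (f s) ≤ 2 * bound n s) →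
                 ∀ s → q * q ^ n * length (spend f s) ≤ 2 * bound n s
  length-spend {n} f h zero = ℕ.≤-trans (ℕ.≤-reflexive (ℕ.*-zeroʳ (q * q ^ n))) z≤n
  length-spend {n} f h (suc s) = begin
    q * q ^ n * length (map (cut ∷_) (f s))  ≡⟨ cong (q * q ^ n *_) (List.length-map _ (f s)) ⟩
    q * q ^ n * length (f s)                 ≡⟨ ℕ.*-assoc q _ _ ⟩
    q * (q ^ n * length (f s))               ≤⟨ ℕ.*-monoʳ-≤ q (h s) ⟩
    q * (2 * bound n s)                      ≡⟨ rearrange q ((q + 2) ^ n) (q ^ s) ⟩
    2 * bound n (suc s)                      ∎
    where
    rearrange : ∀ x y z → x * (2 * (y * z)) ≡ 2 * (y * (x * z))
    rearrange = solve-∀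

  length-step : ∀ {n s} d {ws : List (Vec Side n)} → q ^ n * length ws ≤ bound n s →
                q * q ^ n * length (map (d ∷_) ws) ≤ q * bound n s
  length-step {n} {s} d {ws} h = begin
    q * q ^ n * length (map (d ∷_) ws)  ≡⟨ cong (q * q ^ n *_) (List.length-map _ ws) ⟩
    q * q ^ n * length ws               ≡⟨ ℕ.*-assoc q _ _ ⟩
    q * (q ^ n * length ws)             ≤⟨ ℕ.*-monoʳ-≤ q h ⟩
    q * bound n s                       ∎

  length-++-≤ : ∀ m {k l} {A : Set} (xs : List A) {ys} → m * length xs ≤ k → m * length ys ≤ l →
                m * length (xs ++ ys) ≤ k + l
  length-++-≤ m {k} {l} xs {ys} h h′ = begin
    m * length (xs ++ ys)           ≡⟨ cong (m *_) (List.length-++ xs) ⟩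
    m * (length xs + length ys)     ≡⟨ ℕ.*-distribˡ-+ m _ _ ⟩
    m * length xs + m * length ys   ≤⟨ ℕ.+-mono-≤ h h′ ⟩
    k + l                           ∎

  -- From a left or right vertex the path keeps the colour or spends a cut; the latter divides the
  -- bound by `q` and doubles it, which gives the factor 1 + 2 / q. The doubling pays for the free
  -- choice of colour after a cut vertex.
  length-walks : ∀ n s →
    q ^ n * length (walks n s left) ≤ bound n s ×
    q ^ n * length (walks n s right) ≤ bound n s ×
    q ^ n * length (walks n s cut) ≤ 2 * bound n s
  length-walks zero s = 1≤ , 1≤ , ℕ.≤-trans 1≤ (ℕ.m≤m+n _ _)
    where
    1≤ : 1 ≤ bound 0 s
    1≤ = ℕ.≤-trans (ℕ.m^n>0 q s) (ℕ.m≤m+n _ _)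
  length-walks (suc n) s =
      ℕ.≤-trans (length-++-≤ (q * q ^ n) (map (left ∷_) (walks n s left)) L S)
        (ℕ.≤-reflexive (side q ((q + 2) ^ n) (q ^ s)))
    , ℕ.≤-trans (length-++-≤ (q * q ^ n) (map (right ∷_) (walks n s right)) R S)
        (ℕ.≤-reflexive (side q ((q + 2) ^ n) (q ^ s)))
    , (begin
      q * q ^ n * length (walks (suc n) s cut)
        ≤⟨ length-++-≤ (q * q ^ n) (map (left ∷_) (walks n s left)) L
             (length-++-≤ (q * q ^ n) (map (right ∷_) (walks n s right)) R S) ⟩
      q * bound n s + (q * bound n s + 2 * bound n s)                 ≤⟨ ℕ.m≤m+n _ (2 * bound n s) ⟩
      q * bound n s + (q * bound n s + 2 * bound n s) + 2 * bound n s ≡⟨ both q ((q + 2) ^ n) (q ^ s) ⟩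
      2 * bound (suc n) s                                             ∎)
    where
    ih = length-walks n s
    L = length-step {n} {s} left {walks n s left} (proj₁ ih)
    R = length-step {n} {s} right {walks n s right} (proj₁ (proj₂ ih))
    S = length-spend (λ t → walks n t cut) (λ t → proj₂ (proj₂ (length-walks n t))) s
    side : ∀ q x y → q * (x * y) + 2 * (x * y) ≡ (q + 2) * x * y
    side = solve-∀
    both : ∀ q x y → q * (x * y) + (q * (x * y) + 2 * (x * y)) + 2 * (x * y) ≡ 2 * ((q + 2) * x * y)
    both = solve-∀

-- Matchings that avoid a cut

length-cartesianProduct : ∀ (xs : List A) (ys : List B) →
                          length (cartesianProduct xs ys) ≡ length xs * length ys
length-cartesianProduct []       ys = refl
length-cartesianProduct (x ∷ xs) ys = trans (List.length-++ (map (x ,_) ys))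
  (cong₂ _+_ (List.length-map (x ,_) ys) (length-cartesianProduct xs ys))

-- Perfect matchings and exchanges of partners

transpose-first : ∀ (i j : Fin n) → transpose i j i ≡ j
transpose-first i j rewrite dec-true (i Fin.≟ i) refl = refl

transpose-second : ∀ (i j : Fin n) → transpose i j j ≡ i
transpose-second i j with j Fin.≟ i
... | yes j≡i = j≡i
... | no  _ rewrite dec-true (j Fin.≟ j) refl = refl

transpose-other : ∀ {i j k : Fin n} → k ≢ i → k ≢ j → transpose i j k ≡ k
transpose-other {i = i} {j} {k} k≢i k≢j
  rewrite dec-false (k Fin.≟ i) k≢i | dec-false (k Fin.≟ j) k≢j = refl

-- The proofs are dropped, because double counting compares matchings for equality and proofs of
-- `IsPerfectMatching` contain functions.
matchings : ∀ n → List (Matrix n)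
matchings n = filter isPerfectMatching? (vecs (vecs (true ∷ false ∷ []) n) n)

map-proj₁-mapMaybe : {P : Pred A ℓ₁} (P? : Decidable P) → ∀ xs →
  map proj₁ (mapMaybe (λ x → Maybe.map (x ,_) (dec⇒maybe (P? x))) xs) ≡ filter P? xs
map-proj₁-mapMaybe P? [] = refl
map-proj₁-mapMaybe P? (x ∷ xs) with P? x
... | yes _ = cong (x ∷_) (map-proj₁-mapMaybe P? xs)
... | no  _ = map-proj₁-mapMaybe P? xs

map-perfectMatchings : ∀ n → map proj₁ (perfectMatchings n) ≡ matchings n
map-perfectMatchings n = map-proj₁-mapMaybe isPerfectMatching? (vecs (vecs (true ∷ false ∷ []) n) n)

vecs-unique : {xs : List A} → Unique xs → ∀ n → Unique (vecs xs n)
vecs-unique unique zero    = [] ∷ []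
vecs-unique unique (suc n) =
  Unique.cartesianProductWith⁺ _∷_ Vec.∷-injective unique (vecs-unique unique n)

matchings-unique : ∀ n → Unique (matchings n)
matchings-unique n = Unique.filter⁺ isPerfectMatching?
  (vecs-unique (vecs-unique (((λ ()) ∷ []) ∷ [] ∷ []) n) n)

∈-matchings⁺ : {M : Matrix n} → IsPerfectMatching M → M ∈ matchings n
∈-matchings⁺ = ∈-filter⁺ isPerfectMatching? (∈-vecs (∈-vecs ∈-bools) _)
  where
  ∈-bools : ∀ b → b ∈ true ∷ false ∷ []
  ∈-bools true  = here refl
  ∈-bools false = there (here refl)

∈-matchings⁻ : {M : Matrix n} → M ∈ matchings n → IsPerfectMatching M
∈-matchings⁻ {n = n} M∈ = proj₂ (∈-filter⁻ isPerfectMatching? {xs = vecs (vecs _ n) n} M∈)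

joined-unique : ∀ (M : Matrix n) → IsPerfectMatching M → ∀ {u v w} → Joined M u v → Joined M u w → v ≡ w
joined-unique M (_ , _ , unique) {u} uv uw =
  trans (sym (proj₂ (proj₂ (unique u)) uv)) (proj₂ (proj₂ (unique u)) uw)

joined-≢ : ∀ (M : Matrix n) → IsPerfectMatching M → ∀ {u v} → Joined M u v → u ≢ v
joined-≢ M (_ , irrefl , _) uv refl = irrefl _ uv

-- The matching relabelled by the transposition of `i` and `j`: unless they are partners of each
-- other, the two exchange partners.
conj : Fin n → Fin n → Matrix n → Matrix n
conj i j M = Vec.tabulate λ u → Vec.tabulate λ v → lookup (lookup M (transpose i j u)) (transpose i j v)

lookup-conj : ∀ i j (M : Matrix n) u v →
              lookup (lookup (conj i j M) u) v ≡ lookup (lookup M (transpose i j u)) (transpose i j v)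
lookup-conj i j M u v =
  trans (cong (λ r → lookup r v) (Vec.lookup∘tabulate _ u)) (Vec.lookup∘tabulate _ v)

joined-conj⁻ : ∀ {i j} (M : Matrix n) {u v u′ v′} → transpose i j u ≡ u′ → transpose i j v ≡ v′ →
               Joined (conj i j M) u v → Joined M u′ v′
joined-conj⁻ M refl refl = subst T (lookup-conj _ _ M _ _)

joined-conj⁺ : ∀ {i j} (M : Matrix n) {u v u′ v′} → transpose i j u ≡ u′ → transpose i j v ≡ v′ →
               Joined M u′ v′ → Joined (conj i j M) u v
joined-conj⁺ M refl refl = subst T (sym (lookup-conj _ _ M _ _))

conj-inverse : ∀ i j (M : Matrix n) → conj j i (conj i j M) ≡ M
conj-inverse i j M = trans
  (Vec.tabulate-cong λ u → trans
    (Vec.tabulate-cong λ v → trans (lookup-conj i j M _ _)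
      (cong₂ (λ u v → lookup (lookup M u) v) (transpose-inverse i j) (transpose-inverse i j)))
    (Vec.tabulate∘lookup _))
  (Vec.tabulate∘lookup M)

conj-isPerfectMatching : ∀ i j (M : Matrix n) → IsPerfectMatching M → IsPerfectMatching (conj i j M)
conj-isPerfectMatching i j M (symm , irrefl , unique) =
    (λ u v → joined-conj⁺ M refl refl ∘ symm _ _ ∘ joined-conj⁻ M refl refl)
  , (λ u → irrefl _ ∘ joined-conj⁻ M refl refl)
  , λ u → let v , uv , eq = unique (transpose i j u) in
        transpose j i v
      , joined-conj⁺ M refl (transpose-inverse i j) uv
      , λ uw → trans (cong (transpose j i) (eq (joined-conj⁻ M refl refl uw))) (transpose-inverse j i)

newPartner : ∀ (M : Matrix n) {x y z} → IsPerfectMatching M → Joined M x z → x ≢ y → Joined (conj z y M) x y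
newPartner M {y = y} {z} pm xz x≢y =
  joined-conj⁺ M (transpose-other (joined-≢ M pm xz) x≢y) (transpose-second z y) xz

-- The new matching conj z y M and the pair (x , z) determine M and y, because y is the new partner of x.
switching : {P : Pred (Matrix n) ℓ₁} {Q : Pred (Matrix n) ℓ₂} (P? : Decidable P) (Q? : Decidable Q) →
            ∀ {ys} → Unique ys → ∀ xzs →
            (∀ M y → IsPerfectMatching M → P M → y ∈ ys →
              ∃[ x ] ∃[ z ] (x , z) ∈ xzs × Joined M x z × x ≢ y × Q (conj z y M)) →
            count P? (matchings n) * length ys ≤ count Q? (matchings n) * length xzs
switching {n = n} P? Q? {ys} uniqueYs xzs switch = begin
  count P? (matchings n) * length ys                        ≡⟨ length-cartesianProduct Ps ys ⟨
  length (cartesianProduct Ps ys)                           ≤⟨ length-injective-≤ R unique total inj ⟩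
  length (cartesianProduct (filter Q? (matchings n)) xzs)   ≡⟨ length-cartesianProduct (filter Q? (matchings n)) xzs ⟩
  count Q? (matchings n) * length xzs                       ∎
  where
  open ℕ.≤-Reasoning
  Ps = filter P? (matchings n)
  R : Matrix n × Fin n → Matrix n × (Fin n × Fin n) → Set
  R (M , y) (M′ , x , z) = Joined M x z × x ≢ y × M′ ≡ conj z y M
  unique : Unique (cartesianProduct Ps ys)
  unique = Unique.cartesianProduct⁺ (Unique.filter⁺ P? (matchings-unique n)) uniqueYs
  isPM : ∀ {M y} → (M , y) ∈ cartesianProduct Ps ys → IsPerfectMatching M
  isPM My∈ = ∈-matchings⁻ (proj₁ (∈-filter⁻ P? {xs = matchings n} (proj₁ (∈-cartesianProduct⁻ Ps ys My∈))))
  total : ∀ {My} → My ∈ cartesianProduct Ps ys →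
          ∃[ Mxz ] Mxz ∈ cartesianProduct (filter Q? (matchings n)) xzs × R My Mxz
  total {M , y} My∈ with ∈-cartesianProduct⁻ Ps ys My∈
  ... | M∈ , y∈ with ∈-filter⁻ P? {xs = matchings n} M∈
  ... | M∈′ , pM with ∈-matchings⁻ M∈′
  ... | pm with switch M y pm pM y∈
  ... | x , z , xz∈ , xz , x≢y , qM =
      (conj z y M , x , z)
    , ∈-cartesianProduct⁺ (∈-filter⁺ Q? (∈-matchings⁺ (conj-isPerfectMatching z y M pm)) qM) xz∈
    , xz , x≢y , refl
  inj : ∀ {My My′ Mxz} → My ∈ cartesianProduct Ps ys → My′ ∈ cartesianProduct Ps ys →
        R My Mxz → R My′ Mxz → My ≡ My′
  inj {M , y} {M₁ , y₁} {_ , x , z} My∈ My∈₁ (xz , x≢y , refl) (xz₁ , x≢y₁ , eq) =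
    cong₂ _,_ M≡M₁ y≡y₁
    where
    pm = isPM My∈
    pm₁ = isPM My∈₁
    y≡y₁ : y ≡ y₁
    y≡y₁ = joined-unique (conj z y M) (conj-isPerfectMatching z y M pm) (newPartner M pm xz x≢y)
             (subst (λ M → Joined M x y₁) (sym eq) (newPartner M₁ pm₁ xz₁ x≢y₁))
    M≡M₁ : M ≡ M₁
    M≡M₁ = trans (sym (conj-inverse z y M)) (trans (cong₂ (λ y → conj y z) y≡y₁ eq) (conj-inverse z y₁ M₁))

-- The probability that given left vertices have no right partner

module _ (f : Fin n → Side) where

  Misses : Matrix n → Fin n → Set
  Misses M x = ∀ v → Joined M x v → f v ≢ right

  misses? : ∀ M → Decidable (Misses M)
  misses? M x = Fin.all? λ v → T? _ →-dec ¬? (f v ≟ right)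

  allMiss? : ∀ xs → Decidable (λ M → All (Misses M) xs)
  allMiss? xs M = All.all? (misses? M) xs

  module _ (ys : List (Fin n)) (uniqueYs : Unique ys) (leftYs : All (λ y → f y ≡ left) ys)
           (n≤ : n ≤ 8 * size f right) where

    private
      N : ∀ {P : Pred (Matrix n) ℓ₁} → Decidable P → ℕ
      N P? = count P? (matchings n)

      left≢right : ∀ {u v} → f u ≡ left → f v ≡ right → u ≢ v
      left≢right l r refl = contradiction (trans (sym l) r) λ ()

    -- A matching with x unmatched to the right gives others by an exchange of partners: if the partner of x
    -- is not in xs, move any right vertex next to x; otherwise move any vertex of ys next to that partner.
    module _ (x : Fin n) (xs : List (Fin n)) (x∉xs : x ∉ xs) (lefts : All (λ x → f x ≡ left) (x ∷ xs))
             (disjoint : ∀ {z} → z ∈ x ∷ xs → z ∉ ys) (8*xs≤ys : 8 * suc (length xs) ≤ length ys) where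

      inside? : ∀ M → Dec (Any (Joined M x) xs)
      inside? M = Any.any? (λ z → T? _) xs

      f-x : f x ≡ left
      f-x = All.head lefts

      -- Every right vertex `y` can be moved next to `x`. What is forgotten is the old partner of
      -- `x`, one of `n` vertices.
      outside : N (λ M → allMiss? (x ∷ xs) M ×-dec ¬? (inside? M)) * size f right ≤
                N (λ M → allMiss? xs M ×-dec ¬? (allMiss? (x ∷ xs) M)) * n
      outside = ℕ.≤-trans (switching (λ M → allMiss? (x ∷ xs) M ×-dec ¬? (inside? M))
          (λ M → allMiss? xs M ×-dec ¬? (allMiss? (x ∷ xs) M))
          (Unique.filter⁺ (λ v → f v ≟ right) (Unique.allFin⁺ n)) (map (x ,_) (allFin n)) switch)
        (ℕ.≤-reflexive (cong (N (λ M → allMiss? xs M ×-dec ¬? (allMiss? (x ∷ xs) M)) *_)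
          (trans (List.length-map (x ,_) (allFin n)) (List.length-tabulate id))))
        where
        switch : ∀ M y → IsPerfectMatching M → All (Misses M) (x ∷ xs) × ¬ Any (Joined M x) xs →
                 y ∈ filter (λ v → f v ≟ right) (allFin n) →
                 ∃[ x′ ] ∃[ z ] (x′ , z) ∈ map (x ,_) (allFin n) × Joined M x′ z × x′ ≢ y ×
                 (All (Misses (conj z y M)) xs × ¬ All (Misses (conj z y M)) (x ∷ xs))
        switch M y pm@(symm , _ , partner) (miss , ¬inside) y∈ =
          x , z , ∈-map⁺ _ (∈-allFin z) , xz , x≢y , All.tabulate miss′ , hit
          where
          z = proj₁ (partner x)
          xz : Joined M x z
          xz = proj₁ (proj₂ (partner x))
          f-y : f y ≡ right
          f-y = proj₂ (∈-filter⁻ (λ v → f v ≟ right) {xs = allFin n} y∈)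
          x≢y = left≢right f-x f-y
          fixed : ∀ {u} → u ∈ xs → transpose z y u ≡ u
          fixed u∈ = transpose-other (λ { refl → ¬inside (lose u∈ xz) })
                       (left≢right (All.lookup (All.tail lefts) u∈) f-y)
          miss′ : ∀ {u} → u ∈ xs → Misses (conj z y M) u
          -- The vertices of `xs` are not relabelled. A new edge from `u` to `y` was an edge to `z`,
          -- whose partner is `x`; a new edge to `z` was an edge to the right vertex `y`; any other
          -- edge is old.
          miss′ {u} u∈ v uv r with v Fin.≟ y | v Fin.≟ z
          ... | yes v≡y | _ = x∉xs (subst (_∈ xs) (joined-unique M pm (symm _ _ uz) (symm _ _ xz)) u∈)
            where
            uz = joined-conj⁻ M (fixed u∈) (trans (cong (transpose z y) v≡y) (transpose-second z y)) uv
          ... | no _ | yes v≡z = All.lookup miss (there u∈) y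
            (joined-conj⁻ M (fixed u∈) (trans (cong (transpose z y) v≡z) (transpose-first z y)) uv) f-y
          ... | no v≢y | no v≢z = All.lookup miss (there u∈) v
            (joined-conj⁻ M (fixed u∈) (transpose-other v≢z v≢y) uv) r
          hit : ¬ All (Misses (conj z y M)) (x ∷ xs)
          hit (h ∷ _) = h y (newPartner M pm xz x≢y) f-y

      -- Here little is forgotten: the partner of `x` lies in `xs`, so only `length xs` pairs are
      -- possible, against more than eight times as many choices of `y`.
      inside : N (λ M → allMiss? (x ∷ xs) M ×-dec inside? M) * length ys ≤
               N (allMiss? xs) * length xs
      inside = ℕ.≤-trans (switching (λ M → allMiss? (x ∷ xs) M ×-dec inside? M) (allMiss? xs) uniqueYs
          (map (_, x) xs) switch)
        (ℕ.≤-reflexive (cong (N (allMiss? xs) *_) (List.length-map (_, x) xs)))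
        where
        switch : ∀ M y → IsPerfectMatching M → All (Misses M) (x ∷ xs) × Any (Joined M x) xs → y ∈ ys →
                 ∃[ z ] ∃[ x′ ] (z , x′) ∈ map (_, x) xs × Joined M z x′ × z ≢ y ×
                 All (Misses (conj x′ y M)) xs
        switch M y pm@(symm , _) (miss , ins) y∈ with find ins
        ... | z , z∈ , xz = z , x , ∈-map⁺ _ z∈ , symm _ _ xz , ≢y z∈ , All.tabulate miss′
          where
          ≢y : ∀ {u} → u ∈ xs → u ≢ y
          ≢y u∈ refl = disjoint (there u∈) y∈
          miss′ : ∀ {u} → u ∈ xs → Misses (conj x y M) u
          -- Both relabelled vertices `x` and `y` are left, so an edge from `u` to a right vertex
          -- `v` is an old one.
          miss′ {u} u∈ v uv r = All.lookup miss (there u∈) v (joined-conj⁻ M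
            (transpose-other (λ { refl → x∉xs u∈ }) (≢y u∈))
            (transpose-other (left≢right f-x r ∘ sym) (left≢right (All.lookup leftYs y∈) r ∘ sym)) uv) r

      -- Here `s` and `t` split the matchings counted by `g′` according to `inside?`. The bounds on
      -- `s`, `t` and `d` combine to g′ ≤ 8 (g - g′) + g / 8, which is 72 g′ ≤ 65 g.
      step : 72 * N (allMiss? (x ∷ xs)) ≤ 65 * N (allMiss? xs)
      step = begin
        72 * g′                            ≡⟨ split₁ g′ ⟩
        8 * g′ + 64 * g′                   ≤⟨ ℕ.+-monoˡ-≤ (64 * g′) (ℕ.*-monoʳ-≤ 8 g′≤) ⟩
        8 * (s + t) + 64 * g′              ≡⟨ cong (_+ 64 * g′) (ℕ.*-distribˡ-+ 8 s t) ⟩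
        8 * s + 8 * t + 64 * g′            ≤⟨ ℕ.+-monoˡ-≤ (64 * g′) (ℕ.+-mono-≤ (ℕ.*-monoʳ-≤ 8 s≤) t≤) ⟩
        8 * (8 * d) + g + 64 * g′          ≡⟨ split₂ d g g′ ⟩
        64 * (g′ + d) + g                  ≤⟨ ℕ.+-monoˡ-≤ g (ℕ.*-monoʳ-≤ 64 d≤) ⟩
        64 * g + g                         ≡⟨ split₃ g ⟩
        65 * g                             ∎
        where
        open ℕ.≤-Reasoning
        split₁ : ∀ x → 72 * x ≡ 8 * x + 64 * x
        split₁ = solve-∀
        split₂ : ∀ x y z → 8 * (8 * x) + y + 64 * z ≡ 64 * (z + x) + y
        split₂ = solve-∀
        split₃ : ∀ x → 64 * x + x ≡ 65 * x
        split₃ = solve-∀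
        comm₁ : ∀ x y z → x * (y * z) ≡ y * x * z
        comm₁ = solve-∀
        comm₂ : ∀ x y z → x * y * z ≡ x * z * y
        comm₂ = solve-∀
        g g′ d s t β : ℕ
        g  = N (allMiss? xs)
        g′ = N (allMiss? (x ∷ xs))
        d  = N (λ M → allMiss? xs M ×-dec ¬? (allMiss? (x ∷ xs) M))
        s  = N (λ M → allMiss? (x ∷ xs) M ×-dec ¬? (inside? M))
        t  = N (λ M → allMiss? (x ∷ xs) M ×-dec inside? M)
        β  = size f right
        g′≤ : g′ ≤ s + t
        g′≤ = count-∪ (allMiss? (x ∷ xs)) _ _ (matchings n) λ {M} _ miss →
          Sum.map (miss ,_) (miss ,_) (Sum.swap (toSum (inside? M)))
        d≤ : g′ + d ≤ g
        d≤ = count-⊎ (allMiss? (x ∷ xs)) _ (allMiss? xs) (matchings n)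
               All.tail proj₁ (λ miss (_ , ¬miss) → ¬miss miss)
        s≤ : s ≤ 8 * d
        s≤ = ℕ.*-cancelʳ-≤ s (8 * d) β {{β≢0}} (begin
          s * β         ≤⟨ outside ⟩
          d * n         ≤⟨ ℕ.*-monoʳ-≤ d n≤ ⟩
          d * (8 * β)   ≡⟨ comm₁ d 8 β ⟩
          8 * d * β     ∎)
          where
          β≢0 : NonZero β
          β≢0 = >-nonZero (ℕ.*-cancelˡ-< 8 0 β (ℕ.<-≤-trans (ℕ.≤-<-trans z≤n (Fin.toℕ<n x)) n≤))
        t≤ : 8 * t ≤ g
        t≤ = ℕ.*-cancelʳ-≤ (8 * t) g (length ys) {{>-nonZero (ℕ.≤-trans (s≤s z≤n) 8*xs≤ys)}} (begin
          8 * t * length ys            ≡⟨ ℕ.*-assoc 8 t _ ⟩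
          8 * (t * length ys)          ≤⟨ ℕ.*-monoʳ-≤ 8 inside ⟩
          8 * (g * length xs)          ≡⟨ comm₁ 8 g (length xs) ⟩
          g * 8 * length xs            ≡⟨ ℕ.*-assoc g 8 _ ⟩
          g * (8 * length xs)          ≤⟨ ℕ.*-monoʳ-≤ g (ℕ.≤-trans (ℕ.*-monoʳ-≤ 8 (ℕ.n≤1+n _)) 8*xs≤ys) ⟩
          g * length ys                ∎)

    -- `step` bounds the chance that `x` misses the right side given that all of `xs` do, so the
    -- factors multiply along the list without independence.
    allMiss-rare : ∀ xs → Unique xs → All (λ x → f x ≡ left) xs → (∀ {z} → z ∈ xs → z ∉ ys) →
                   8 * length xs ≤ length ys →
                   72 ^ length xs * N (allMiss? xs) ≤ 65 ^ length xs * length (matchings n)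
    allMiss-rare [] _ _ _ _ = ℕ.*-monoʳ-≤ 1 (List.length-filter _ (matchings n))
    allMiss-rare (x ∷ xs) (x∉xs ∷ unique) lefts disjoint 8*xs≤ys = begin
      72 * 72 ^ l * N (allMiss? (x ∷ xs))     ≡⟨ left-comm 72 (72 ^ l) _ ⟩
      72 ^ l * (72 * N (allMiss? (x ∷ xs)))   ≤⟨ ℕ.*-monoʳ-≤ (72 ^ l)
                                                  (step x xs (λ x∈ → All.lookup x∉xs x∈ refl) lefts disjoint 8*xs≤ys) ⟩
      72 ^ l * (65 * N (allMiss? xs))         ≡⟨ left-comm 65 (72 ^ l) _ ⟨
      65 * 72 ^ l * N (allMiss? xs)           ≡⟨ ℕ.*-assoc 65 (72 ^ l) _ ⟩
      65 * (72 ^ l * N (allMiss? xs))         ≤⟨ ℕ.*-monoʳ-≤ 65 (allMiss-rare xs unique (All.tail lefts)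
                                                  (disjoint ∘ there) (ℕ.≤-trans (ℕ.*-monoʳ-≤ 8 (ℕ.n≤1+n _)) 8*xs≤ys)) ⟩
      65 * (65 ^ l * length (matchings n))    ≡⟨ ℕ.*-assoc 65 (65 ^ l) _ ⟨
      65 * 65 ^ l * length (matchings n)      ∎
      where
      open ℕ.≤-Reasoning
      l = length xs
      left-comm : ∀ x y z → x * y * z ≡ y * (x * z)
      left-comm = solve-∀

-- The union bound

take-drop-disjoint : ∀ {xs : List A} → Unique xs → ∀ m {z} → z ∈ take m xs → z ∉ drop m xs
take-drop-disjoint (x∉xs ∷ _)      (suc m) (here refl) z∈drop = All.lookup (All.drop⁺ m x∉xs) z∈drop refl
take-drop-disjoint (_    ∷ unique) (suc m) (there z∈)  z∈drop = take-drop-disjoint unique m z∈ z∈drop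

count-Any : {Q : B → Pred A ℓ₂} (Q? : ∀ w → Decidable (Q w)) → ∀ ws xs {k l} →
            (∀ {w} → w ∈ ws → k * count (Q? w) xs ≤ l) →
            k * count (λ x → Any.any? (λ w → Q? w x) ws) xs ≤ length ws * l
count-Any Q? [] xs {k} bound = ℕ.≤-reflexive (trans (cong (k *_) (none xs)) (ℕ.*-zeroʳ k))
  where
  none : ∀ xs → count (λ x → Any.any? (λ w → Q? w x) []) xs ≡ 0
  none []       = refl
  none (x ∷ xs) = none xs
count-Any Q? (w ∷ ws) xs {k} {l} bound = begin
  k * count (λ x → Any.any? (λ w → Q? w x) (w ∷ ws)) xs
    ≤⟨ ℕ.*-monoʳ-≤ k (count-∪ _ (Q? w) (λ x → Any.any? (λ w → Q? w x) ws) xs λ _ → Any.toSum) ⟩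
  k * (count (Q? w) xs + count (λ x → Any.any? (λ w → Q? w x) ws) xs)
    ≡⟨ ℕ.*-distribˡ-+ k _ _ ⟩
  k * count (Q? w) xs + k * count (λ x → Any.any? (λ w → Q? w x) ws) xs
    ≤⟨ ℕ.+-mono-≤ (bound (here refl)) (count-Any Q? ws xs {k} (bound ∘ there)) ⟩
  l + length ws * l
    ∎
  where open ℕ.≤-Reasoning

-- Existence of a perfect matching on an even number of vertices

fromInvolution : ∀ {n} → (Fin n → Fin n) → Matrix n
fromInvolution f = Vec.tabulate λ u → Vec.tabulate λ v → isYes (f u Fin.≟ v)

module _ {n} {f : Fin n → Fin n} where

  lookup-fromInvolution : ∀ u v → lookup (lookup (fromInvolution f) u) v ≡ isYes (f u Fin.≟ v)
  lookup-fromInvolution u v =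
    trans (cong (λ r → lookup r v) (Vec.lookup∘tabulate _ u)) (Vec.lookup∘tabulate _ v)

  joined⇒≡ : ∀ {u v} → Joined (fromInvolution f) u v → f u ≡ v
  joined⇒≡ = toWitness ∘ subst T (lookup-fromInvolution _ _)

  ≡⇒joined : ∀ {u v} → f u ≡ v → Joined (fromInvolution f) u v
  ≡⇒joined = subst T (sym (lookup-fromInvolution _ _)) ∘ fromWitness

  fromInvolution-isPerfectMatching : (∀ u → f (f u) ≡ u) → (∀ u → f u ≢ u) →
                                     IsPerfectMatching (fromInvolution f)
  fromInvolution-isPerfectMatching involutive fixedPointFree =
      (λ u v uv → ≡⇒joined (trans (cong f (sym (joined⇒≡ uv))) (involutive u)))
    , (λ u → fixedPointFree u ∘ joined⇒≡)
    , λ u → f u , ≡⇒joined refl , joined⇒≡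

flip : ∀ m → Fin (m * 2) → Fin (m * 2)
flip (suc m) zero          = suc zero
flip (suc m) (suc zero)    = zero
flip (suc m) (suc (suc i)) = suc (suc (flip m i))

flip-involutive : ∀ m i → flip m (flip m i) ≡ i
flip-involutive (suc m) zero          = refl
flip-involutive (suc m) (suc zero)    = refl
flip-involutive (suc m) (suc (suc i)) = cong (λ j → suc (suc j)) (flip-involutive m i)

flip-≢ : ∀ m i → flip m i ≢ i
flip-≢ (suc m) (suc (suc i)) eq = flip-≢ m i (Fin.suc-injective (Fin.suc-injective eq))

-- `flip m` pairs the vertices 2 i and 2 i + 1. This is where the parity of `n` enters; it secures a
-- strict bound on the number of bad matchings even when there are none.
matchings-nonempty : ∀ {n} → 2 ∣ n → 0 < length (matchings n)
matchings-nonempty (divides m refl) = ∈⇒0<length (∈-matchings⁺ {M = fromInvolution (flip m)}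
  (fromInvolution-isPerfectMatching (flip-involutive m) (flip-≢ m)))
  where
  ∈⇒0<length : ∀ {A : Set} {x : A} {xs} → x ∈ xs → 0 < length xs
  ∈⇒0<length (here _)  = s≤s z≤n
  ∈⇒0<length (there _) = s≤s z≤n

-- The probability that a given colouring separates

separates? : ∀ {n} (f : Fin n → Side) → Decidable (λ (M : Matrix n) → Separates f (Joined M))
separates? f M = Fin.all? λ u → Fin.all? λ v → T? _ →-dec ((f u ≟ left) →-dec ¬? (f v ≟ right))

-- The first `σ` left vertices are the ones tested. At least `8 * σ` others remain as the reserve
-- `ys` that `allMiss-rare` asks for, which explains the 9.
separates-rare : ∀ {n} (f : Fin n → Side) σ → 9 * σ ≤ size f left → n ≤ 8 * size f right →
                 72 ^ σ * count (separates? f) (matchings n) ≤ 65 ^ σ * length (matchings n)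
separates-rare {n} f σ 9σ≤ n≤ = begin
  72 ^ σ * count (separates? f) (matchings n)
    ≤⟨ ℕ.*-monoʳ-≤ (72 ^ σ) (count-mono (separates? f) (allMiss? f xs) (matchings n)
         λ _ sep → All.map (λ l v xv → sep _ v xv l) leftXs) ⟩
  72 ^ σ * count (allMiss? f xs) (matchings n)
    ≡⟨ cong (λ m → 72 ^ m * count (allMiss? f xs) (matchings n)) length-xs ⟨
  72 ^ length xs * count (allMiss? f xs) (matchings n)
    ≤⟨ allMiss-rare f ys (Unique.drop⁺ σ unique) (All.drop⁺ σ lefts) n≤ xs (Unique.take⁺ σ unique) leftXs
         (take-drop-disjoint unique σ) 8*xs≤ys ⟩
  65 ^ length xs * length (matchings n)
    ≡⟨ cong (λ m → 65 ^ m * length (matchings n)) length-xs ⟩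
  65 ^ σ * length (matchings n)
    ∎
  where
  open ℕ.≤-Reasoning
  vs = filter (λ v → f v ≟ left) (allFin n)
  xs = take σ vs
  ys = drop σ vs
  unique : Unique vs
  unique = Unique.filter⁺ (λ v → f v ≟ left) (Unique.allFin⁺ n)
  lefts : All (λ v → f v ≡ left) vs
  lefts = All.all-filter (λ v → f v ≟ left) (allFin n)
  leftXs : All (λ v → f v ≡ left) xs
  leftXs = All.take⁺ σ lefts
  length-xs : length xs ≡ σ
  length-xs = trans (List.length-take σ vs) (ℕ.m≤n⇒m⊓n≡m (ℕ.≤-trans (ℕ.m≤n*m σ 9) 9σ≤))
  8*xs≤ys : 8 * length xs ≤ length ys
  8*xs≤ys = begin
    8 * length xs     ≡⟨ cong (8 *_) length-xs ⟩
    8 * σ             ≡⟨ ℕ.m+n∸m≡n σ (8 * σ) ⟨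
    9 * σ ∸ σ         ≤⟨ ℕ.∸-monoˡ-≤ σ 9σ≤ ⟩
    length vs ∸ σ     ≡⟨ List.length-drop σ vs ⟨
    length ys         ∎

size-cong : ∀ {n} {f g : Fin n → Side} → (∀ v → f v ≡ g v) → ∀ c → size f c ≤ size g c
size-cong {n} f≗g c = count-mono _ _ (allFin n) λ {v} _ eq → trans (sym (f≗g v)) eq

size-total : ∀ {n} (f : Fin n → Side) → n ≤ size f left + (size f right + size f cut)
size-total {n} f = begin
  n                                              ≡⟨ List.length-tabulate id ⟨
  length (allFin n)                              ≡⟨ count-all U? _ (allFin n) ⟨
  count U? (allFin n)
    ≤⟨ count-∪ U? (λ v → f v ≟ left) notLeft? (allFin n) (λ {v} _ _ → toSum (f v ≟ left)) ⟩
  size f left + count notLeft? (allFin n)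
    ≤⟨ ℕ.+-monoʳ-≤ (size f left) (count-∪ notLeft? (λ v → f v ≟ right) (λ v → f v ≟ cut) (allFin n)
         λ {v} _ → classify v) ⟩
  size f left + (size f right + size f cut)      ∎
  where
  open ℕ.≤-Reasoning
  notLeft? : ∀ v → Dec (f v ≢ left)
  notLeft? v = ¬? (f v ≟ left)
  classify : ∀ v → f v ≢ left → f v ≡ right ⊎ f v ≡ cut
  classify v ¬l with f v
  ... | left  = contradiction refl ¬l
  ... | right = inj₁ refl
  ... | cut   = inj₂ refl

-- From separating colourings to the entanglement number

module _ (n t σ : ℕ) where

  Balanced : Vec Side n → Set
  Balanced w = 9 * σ ≤ size (lookup w) left × n ≤ 8 * size (lookup w) right

  balanced? : Decidable Balanced
  balanced? w = (9 * σ ℕ.≤? size (lookup w) left) ×-dec (n ℕ.≤? 8 * size (lookup w) right)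

  -- The vertex before the path is imaginary: its colour `cut` leaves the first colour free and is
  -- not charged to the budget `t`.
  splits : List (Vec Side n)
  splits = filter balanced? (walks n t cut)

  Splittable : Pred (Matrix n) _
  Splittable M = Any (λ w → Separates (lookup w) (Joined M)) splits

  splittable? : Decidable Splittable
  splittable? M = Any.any? (λ w → separates? (lookup w) M) splits

  splittable-rare : 72 ^ σ * count splittable? (matchings n) ≤
                    length (walks n t cut) * (65 ^ σ * length (matchings n))
  splittable-rare = ℕ.≤-trans
    (count-Any (λ w → separates? (lookup w)) splits (matchings n) {72 ^ σ}
      {65 ^ σ * length (matchings n)} λ {w} w∈ →
      let left≥ , right≥ = proj₂ (∈-filter⁻ balanced? {xs = walks n t cut} w∈)
      in  separates-rare (lookup w) σ left≥ right≥)
    (ℕ.*-monoˡ-≤ _ (List.length-filter balanced? (walks n t cut)))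

  module _ (M : PerfectMatching n) (fits : 8 * (2 * (9 * σ) + t) ≤ 7 * n)
           (¬splittable : ¬ Splittable (proj₁ M)) where

    -- A colouring that violates the claim belongs to `splits`: the cycle edges put it among the
    -- `walks`, and by `fits` the left and cut vertices leave at least an eighth of all vertices to
    -- the right side. The matching edges then make `M` splittable.
    unsplittable : ∀ {k} → k ≤ t → Unsplittable (cycle n ∪ toGraph M) k (9 * σ)
    unsplittable {k} k≤t f separates cut≤ left≤ = decidable-stable (size f left ℕ.<? 9 * σ) λ ≮ →
      ¬splittable (lose (∈-filter⁺ balanced? (∈-walks w t cut path first cut≤t)
          (ℕ.≤-trans (ℕ.≮⇒≥ ≮) (size-cong (sym ∘ w≗f) left)
          , ℕ.≤-trans right≥ (ℕ.*-monoʳ-≤ 8 (size-cong (sym ∘ w≗f) right))))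
        λ u v uv l r → separates u v (inj₂ uv) (trans (sym (w≗f u)) l) (trans (sym (w≗f v)) r))
      where
      w : Vec Side n
      w = Vec.tabulate f
      w≗f : ∀ v → lookup w v ≡ f v
      w≗f = Vec.lookup∘tabulate f
      cut≤t : size (lookup w) cut ≤ t
      cut≤t = ℕ.≤-trans (size-cong w≗f cut) (ℕ.≤-trans cut≤ k≤t)
      first : ∀ i → toℕ i ≡ 0 → Compatible cut (lookup w i)
      first _ _ cut≢cut = contradiction refl cut≢cut
      compatible : ∀ c d → ¬ (c ≡ left × d ≡ right) → ¬ (d ≡ left × c ≡ right) → Compatible c d
      compatible left  left  _   _   _ _ = refl
      compatible left  right ¬lr _   _ _ = contradiction (refl , refl) ¬lr
      compatible left  cut   _   _   _ c = contradiction refl c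
      compatible right left  _   ¬rl _ _ = contradiction (refl , refl) ¬rl
      compatible right right _   _   _ _ = refl
      compatible right cut   _   _   _ c = contradiction refl c
      compatible cut   _     _   _   c _ = contradiction refl c
      path : ∀ i j → toℕ j ≡ suc (toℕ i) → Compatible (lookup w i) (lookup w j)
      path i j eq rewrite w≗f i | w≗f j = compatible (f i) (f j)
        (λ (l , r) → separates i j (inj₁ (i≢j , inj₁ (inj₁ eq))) l r)
        (λ (l , r) → separates j i (inj₁ (i≢j ∘ sym , inj₂ (inj₁ eq))) l r)
        where
        i≢j : i ≢ j
        i≢j refl = ℕ.1+n≢n (sym eq)
      right≥ : n ≤ 8 * size f right
      right≥ = ℕ.+-cancelˡ-≤ (7 * n) _ _ (begin
        7 * n + n                                             ≡⟨ ℕ.+-comm (7 * n) n ⟩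
        8 * n                                                 ≤⟨ ℕ.*-monoʳ-≤ 8 (size-total f) ⟩
        8 * (size f left + (size f right + size f cut))       ≡⟨ shuffle (size f left) _ _ ⟩
        8 * (size f left + size f cut) + 8 * size f right
          ≤⟨ ℕ.+-monoˡ-≤ _ (ℕ.≤-trans (ℕ.*-monoʳ-≤ 8 (ℕ.+-mono-≤ left≤ (ℕ.≤-trans cut≤ k≤t))) fits) ⟩
        7 * n + 8 * size f right                              ∎)
        where
        open ℕ.≤-Reasoning
        shuffle : ∀ x y z → 8 * (x + (y + z)) ≡ 8 * (x + z) + 8 * y
        shuffle = solve-∀

    -- If `ent` were at most `t`, the escape would apply with `ent` itself as the number of cops,
    -- for which `ent-least` provides a win.
    t<ent : 0 < σ → 9 * σ ≤ n → t < ent (cycle n ∪ toGraph M)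
    t<ent 0<σ 9σ≤n = ℕ.≰⇒> λ ent≤t →
      ¬copsWin (cycle n ∪ toGraph M) (unsplittable ent≤t) (ℕ.≤-trans 0<σ (ℕ.m≤n*m σ 9)) 9σ≤n
        (proj₁ (ent-least (cycle n ∪ toGraph M)))

-- From natural numbers to rational probabilities

*fromℕ-< : ∀ d .{{_ : NonZero d}} n m → n < d * m → pos 1 ℚ./ d ℚ.* fromℕ n ℚ.< fromℕ m
*fromℕ-< (suc d) n m n< = ℚ.toℚᵘ-cancel-<
  (ℚᵘ.<-respˡ-≃ (ℚᵘ.≃-sym lhs) (ℚᵘ.<-respʳ-≃ (ℚᵘ.≃-sym (ℚ.toℚᵘ-fromℚᵘ (ℚᵘ.mkℚᵘ (pos m) 0)))
    (ℚᵘ.*<* (subst₂ ℤ._<_ (lhsℤ n) (rhsℤ m) (ℤ.+<+ n<)))))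
  where
  lhs : ℚ.toℚᵘ (pos 1 ℚ./ suc d ℚ.* fromℕ n) ℚᵘ.≃ ℚᵘ.mkℚᵘ (pos 1) d ℚᵘ.* ℚᵘ.mkℚᵘ (pos n) 0
  lhs = ℚᵘ.≃-trans (ℚ.toℚᵘ-homo-* (pos 1 ℚ./ suc d) (fromℕ n))
          (ℚᵘ.*-cong (ℚ.toℚᵘ-fromℚᵘ (ℚᵘ.mkℚᵘ (pos 1) d)) (ℚ.toℚᵘ-fromℚᵘ (ℚᵘ.mkℚᵘ (pos n) 0)))
  lhsℤ : ∀ n → pos n ≡ pos 1 ℤ.* pos n ℤ.* pos 1
  lhsℤ n = sym (trans (ℤ.*-identityʳ _) (ℤ.*-identityˡ (pos n)))
  rhsℤ : ∀ m → pos (suc d * m) ≡ pos m ℤ.* pos (suc d * 1)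
  rhsℤ m = trans (cong pos (trans (ℕ.*-comm (suc d) m) (cong (m *_) (sym (ℕ.*-identityʳ (suc d))))))
             (ℤ.pos-* m (suc d * 1))

-- The distance is the share of exceptions, and `ε` is at least 1 / `↧ₙ ε` because its numerator is
-- positive. The strict inequality also rules out the empty list, where `Pr` is 0 by convention.
Pr-near-1 : {P : Pred A ℓ₁} (P? : Decidable P) → ∀ xs ε → 0ℚ ℚ.< ε →
            count (¬? ∘ P?) xs * ↧ₙ ε < length xs → ℚ.∣ Pr xs P? ℚ.- 1ℚ ∣ ℚ.< ε
Pr-near-1 P? xs@(x ∷ ys) ε 0<ε rare with ℚ.positive 0<ε
Pr-near-1 P? xs@(x ∷ ys) ε@(mkℚ +[1+ e ] d _) 0<ε rare | _ = ℚ.toℚᵘ-cancel-<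
  (ℚᵘ.<-respˡ-≃ (ℚᵘ.≃-sym (ℚᵘ.≃-trans (ℚ.toℚᵘ-homo-∣-∣ (Pr xs P? ℚ.- 1ℚ)) (ℚᵘ.∣-∣-cong difference)))
    (ℚᵘ.*<* (subst₂ ℤ._<_ lhs (ℤ.pos-* (suc e) (suc l)) (ℤ.+<+ (ℕ.<-≤-trans rare (ℕ.m≤n*m (suc l) (suc e)))))))
  where
  l = length ys
  g = count P? xs
  b = count (¬? ∘ P?) xs
  total : pos g ℤ.+ pos b ≡ pos (suc l)
  total = cong pos (count-¬ xs)
    where
    count-¬ : ∀ xs → count P? xs + count (¬? ∘ P?) xs ≡ length xs
    count-¬ [] = refl
    count-¬ (x ∷ xs) with P? x
    ... | yes _ = cong suc (count-¬ xs)
    ... | no  _ = trans (ℕ.+-suc _ _) (cong suc (count-¬ xs))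
  lhs : pos (b * suc d) ≡ pos ℤ.∣ ℤ.- pos b ∣ ℤ.* pos (suc d)
  lhs = trans (ℤ.pos-* b (suc d)) (cong (λ m → pos m ℤ.* pos (suc d)) (sym (ℤ.∣-i∣≡∣i∣ (pos b))))
  difference : ℚ.toℚᵘ (Pr xs P? ℚ.- 1ℚ) ℚᵘ.≃ ℚᵘ.mkℚᵘ (ℤ.- pos b) l
  difference = ℚᵘ.≃-trans (ℚ.toℚᵘ-homo-+ (Pr xs P?) (ℚ.- 1ℚ))
    (ℚᵘ.≃-trans (ℚᵘ.+-congˡ (ℚᵘ.- ℚᵘ.1ℚᵘ) (ℚ.toℚᵘ-fromℚᵘ (ℚᵘ.mkℚᵘ (pos g) l)))
      (ℚᵘ.*≡* (trans (cong (λ x → (pos g ℤ.* pos 1 ℤ.+ ℤ.- (pos 1) ℤ.* x) ℤ.* pos (suc l)) (sym total))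
        (trans (ring (pos g) (pos b) (pos (suc l))) (cong (λ m → ℤ.- pos b ℤ.* pos m) (sym (ℕ.*-identityʳ (suc l))))))))
    where
    ring : ∀ x y z → (x ℤ.* pos 1 ℤ.+ ℤ.- (pos 1) ℤ.* (x ℤ.+ y)) ℤ.* z ≡ ℤ.- y ℤ.* z
    ring = ℤSolver.solve-∀

-- Exponential decay of the union bound

^-distribʳ-* : ∀ x y k → (x * y) ^ k ≡ x ^ k * y ^ k
^-distribʳ-* x y zero    = refl
^-distribʳ-* x y (suc k) =
  trans (cong (x * y *_) (^-distribʳ-* x y k)) (interchange x y (x ^ k) (y ^ k))
  where
  interchange : ∀ x y z w → x * y * (z * w) ≡ x * z * (y * w)
  interchange = solve-∀

n<2^n : ∀ n → n < 2 ^ n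
n<2^n zero    = s≤s z≤n
n<2^n (suc n) = ℕ.≤-trans (ℕ.+-mono-≤ (ℕ.m^n>0 2 n) (n<2^n n))
  (ℕ.≤-reflexive (cong (2 ^ n +_) (sym (ℕ.+-identityʳ _))))

-- `decay` says that `D` more vertices, one more cut vertex and `E` more tested vertices change the
-- union bound by a factor of at most 1 / 2.
module _ (q E : ℕ) .{{_ : NonZero q}} .{{_ : NonZero E}}
         (decay : 2 * ((q + 2) ^ (40 * E) * q * 65 ^ E) ≤ q ^ (40 * E) * 72 ^ E) where

  -- Later `t = n / D` and `σ = E * t`, so that `40 * σ ≤ n`. This leaves room for `2 * (9 * σ)`
  -- left vertices, `t` cut vertices and an eighth of all vertices on the right.
  D : ℕ
  D = 40 * E

  instance
    D≢0 : NonZero D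
    D≢0 = ℕ.m*n≢0 40 E

  -- Absorbs the factor 2 and the contribution of the remainder of `n` modulo `D`.
  K : ℕ
  K = 2 * (q + 2) ^ D

  -- The number of splits is at most 2 ((q + 2) / q)ⁿ qᵗ, and each of them has probability at most
  -- (65 / 72) ^ (E t).
  union-bound-decays : ∀ r t b l N → r ≤ D →
             q ^ (r + D * t) * l ≤ 2 * ((q + 2) ^ (r + D * t) * q ^ t) →
             72 ^ (E * t) * b ≤ l * (65 ^ (E * t) * N) →
             2 ^ t * b ≤ K * N
  union-bound-decays r t b l N r≤D few rare = ℕ.*-cancelˡ-≤ (y ^ t) {{ℕ.m^n≢0 y t {{y≢0}}}} (begin
    y ^ t * (2 ^ t * b)                 ≡⟨ assoc (y ^ t) (2 ^ t) b ⟩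
    2 ^ t * y ^ t * b                   ≡⟨ cong (_* b) (^-distribʳ-* 2 y t) ⟨
    (2 * y) ^ t * b                     ≤⟨ ℕ.*-monoˡ-≤ b (ℕ.^-monoˡ-≤ t decay) ⟩
    (q ^ D * 72 ^ E) ^ t * b            ≤⟨ ℕ.m≤n*m _ (q ^ r) {{ℕ.m^n≢0 q r}} ⟩
    q ^ r * ((q ^ D * 72 ^ E) ^ t * b)  ≡⟨ cong (λ z → q ^ r * (z * b)) (^-distribʳ-* (q ^ D) (72 ^ E) t) ⟩
    q ^ r * ((q ^ D) ^ t * (72 ^ E) ^ t * b)
      ≡⟨ cong₂ (λ x z → q ^ r * (x * z * b)) (ℕ.^-*-assoc q D t) (ℕ.^-*-assoc 72 E t) ⟩
    q ^ r * (q ^ (D * t) * 72 ^ (E * t) * b)  ≡⟨ regroup (q ^ r) (q ^ (D * t)) (72 ^ (E * t)) b ⟩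
    q ^ r * q ^ (D * t) * (72 ^ (E * t) * b)  ≡⟨ cong (_* (72 ^ (E * t) * b)) (ℕ.^-distribˡ-+-* q r (D * t)) ⟨
    q ^ m * (72 ^ (E * t) * b)          ≤⟨ ℕ.*-monoʳ-≤ (q ^ m) rare ⟩
    q ^ m * (l * (65 ^ (E * t) * N))    ≡⟨ ℕ.*-assoc (q ^ m) l _ ⟨
    q ^ m * l * (65 ^ (E * t) * N)      ≤⟨ ℕ.*-monoˡ-≤ (65 ^ (E * t) * N) few ⟩
    2 * ((q + 2) ^ m * q ^ t) * (65 ^ (E * t) * N)
      ≡⟨ cong (λ z → 2 * (z * q ^ t) * (65 ^ (E * t) * N)) (ℕ.^-distribˡ-+-* (q + 2) r (D * t)) ⟩
    2 * ((q + 2) ^ r * (q + 2) ^ (D * t) * q ^ t) * (65 ^ (E * t) * N)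
      ≡⟨ regroup′ ((q + 2) ^ r) ((q + 2) ^ (D * t)) (q ^ t) (65 ^ (E * t)) N ⟩
    2 * (q + 2) ^ r * ((q + 2) ^ (D * t) * q ^ t * 65 ^ (E * t) * N)
      ≡⟨ cong₂ (λ x z → 2 * (q + 2) ^ r * (x * q ^ t * z * N)) (ℕ.^-*-assoc (q + 2) D t) (ℕ.^-*-assoc 65 E t) ⟨
    2 * (q + 2) ^ r * (((q + 2) ^ D) ^ t * q ^ t * (65 ^ E) ^ t * N)
      ≡⟨ cong (λ z → 2 * (q + 2) ^ r * (z * (65 ^ E) ^ t * N)) (^-distribʳ-* ((q + 2) ^ D) q t) ⟨
    2 * (q + 2) ^ r * (((q + 2) ^ D * q) ^ t * (65 ^ E) ^ t * N)
      ≡⟨ cong (λ z → 2 * (q + 2) ^ r * (z * N)) (^-distribʳ-* ((q + 2) ^ D * q) (65 ^ E) t) ⟨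
    2 * (q + 2) ^ r * (y ^ t * N)
      ≤⟨ ℕ.*-monoˡ-≤ (y ^ t * N) (ℕ.*-monoʳ-≤ 2 (ℕ.^-monoʳ-≤ (q + 2) {{q+2≢0}} r≤D)) ⟩
    K * (y ^ t * N)                     ≡⟨ swap K (y ^ t) N ⟩
    y ^ t * (K * N)                     ∎)
    where
    open ℕ.≤-Reasoning
    m = r + D * t
    y = (q + 2) ^ D * q * 65 ^ E
    q+2≢0 : NonZero (q + 2)
    q+2≢0 = >-nonZero (ℕ.m≤n⇒m≤o+n q (s≤s z≤n))
    y≢0 : NonZero y
    y≢0 = ℕ.m*n≢0 _ _ {{ℕ.m*n≢0 _ _ {{ℕ.m^n≢0 _ D {{q+2≢0}}}}}} {{ℕ.m^n≢0 65 E}}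
    assoc : ∀ x y z → x * (y * z) ≡ y * x * z
    assoc = solve-∀
    swap : ∀ x y z → x * (y * z) ≡ y * (x * z)
    swap = solve-∀
    regroup : ∀ x y z w → x * (y * z * w) ≡ x * y * (z * w)
    regroup = solve-∀
    regroup′ : ∀ x y z w v → 2 * (x * y * z) * (w * v) ≡ 2 * x * (y * z * w * v)
    regroup′ = solve-∀

  -- Since `2 ^ t` exceeds `t`, it exceeds `K * d`. The case `b = 0` is separate because
  -- multiplication by `b` is strict only for positive `b`.
  rare⇒< : ∀ b N d t → 2 ^ t * b ≤ K * N → K * d ≤ t → 0 < N → b * d < N
  rare⇒< zero    N d t _  _ 0<N = 0<N
  rare⇒< b@(suc _) N d t rare t≥ _ = ℕ.*-cancelˡ-< K (b * d) N (begin-strict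
    K * (b * d)   ≡⟨ shuffle K b d ⟩
    K * d * b     <⟨ ℕ.*-monoˡ-< b (ℕ.≤-<-trans t≥ (n<2^n t)) ⟩
    2 ^ t * b     ≤⟨ rare ⟩
    K * N         ∎)
    where
    open ℕ.≤-Reasoning
    shuffle : ∀ x y z → x * (y * z) ≡ x * z * y
    shuffle = solve-∀

  α : ℚ
  α = pos 1 ℚ./ D

  ent-linear : ∀ ε → 0ℚ ℚ.< ε → ∀ n → D * suc (K * ↧ₙ ε) ≤ n → 2 ∣ n →
    ℚ.∣ Pr (perfectMatchings n) (λ M → α ℚ.* fromℕ n ℚ.<? fromℕ (ent (cycle n ∪ toGraph M))) ℚ.- 1ℚ ∣ ℚ.< ε
  ent-linear ε 0<ε n N≤n even = Pr-near-1 Many? (perfectMatchings n) ε 0<ε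
      (ℕ.≤-<-trans (ℕ.*-monoˡ-≤ (↧ₙ ε) bad≤)
        (subst (count (splittable? n t σ) (matchings n) * ↧ₙ ε <_) (sym length≡)
          (rare⇒< _ _ (↧ₙ ε) t
            (union-bound-decays r t _ (length (walks n t cut)) _ (ℕ.<⇒≤ (m%n<n n D))
              (subst (λ m → q ^ m * length (walks n t cut) ≤ 2 * ((q + 2) ^ m * q ^ t)) n≡
                (proj₂ (proj₂ (length-walks q n t))))
              (splittable-rare n t σ))
            (ℕ.≤-trans (ℕ.n≤1+n _) t≥) (matchings-nonempty even))))
    where
    t r σ : ℕ
    t = n / D
    r = n % D
    σ = E * t
    n≡ : n ≡ r + D * t
    n≡ = trans (m≡m%n+[m/n]*n n D) (cong (r +_) (ℕ.*-comm t D))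
    Dt≤n : D * t ≤ n
    Dt≤n = ℕ.≤-trans (ℕ.m≤n+m (D * t) r) (ℕ.≤-reflexive (sym n≡))
    -- The threshold on `n` is made for this: `rare⇒<` asks for `K * ↧ₙ ε ≤ t`, and one more keeps
    -- `t` and `σ` positive.
    t≥ : suc (K * ↧ₙ ε) ≤ t
    t≥ = ℕ.≤-trans (ℕ.≤-reflexive (trans (sym (m*n/n≡m _ D)) (cong (_/ D) (ℕ.*-comm _ D)))) (/-monoˡ-≤ D N≤n)
    instance
      t≢0 : NonZero t
      t≢0 = >-nonZero (ℕ.≤-trans (s≤s z≤n) t≥)
    0<σ : 0 < σ
    0<σ = >-nonZero⁻¹ σ {{ℕ.m*n≢0 E t}}
    9σ≤n : 9 * σ ≤ n
    9σ≤n = begin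
      9 * (E * t)    ≤⟨ ℕ.*-monoˡ-≤ (E * t) (ℕ.m≤m+n 9 31) ⟩
      40 * (E * t)   ≡⟨ ℕ.*-assoc 40 E t ⟨
      D * t          ≤⟨ Dt≤n ⟩
      n              ∎
      where open ℕ.≤-Reasoning
    -- As `E` is positive, `t ≤ σ`. So left and cut vertices number at most `19 * σ`, and 8 * 19 =
    -- 152 is below 7 * 40 = 280.
    fits : 8 * (2 * (9 * σ) + t) ≤ 7 * n
    fits = begin
      8 * (2 * (9 * σ) + t)    ≤⟨ ℕ.*-monoʳ-≤ 8 (ℕ.+-monoʳ-≤ (2 * (9 * σ)) (ℕ.m≤n*m t E)) ⟩
      8 * (2 * (9 * σ) + σ)    ≡⟨ collect₁ σ ⟩
      152 * σ                  ≤⟨ ℕ.*-monoˡ-≤ σ (ℕ.m≤m+n 152 128) ⟩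
      280 * σ                  ≡⟨ collect₂ E t ⟩
      7 * (D * t)              ≤⟨ ℕ.*-monoʳ-≤ 7 Dt≤n ⟩
      7 * n                    ∎
      where
      open ℕ.≤-Reasoning
      collect₁ : ∀ x → 8 * (2 * (9 * x) + x) ≡ 152 * x
      collect₁ = solve-∀
      collect₂ : ∀ x y → 280 * (x * y) ≡ 7 * (40 * x * y)
      collect₂ = solve-∀
    length≡ : length (perfectMatchings n) ≡ length (matchings n)
    length≡ = trans (sym (List.length-map proj₁ (perfectMatchings n))) (cong length (map-perfectMatchings n))
    Many? : ∀ M → Dec (α ℚ.* fromℕ n ℚ.< fromℕ (ent (cycle n ∪ toGraph M)))
    Many? M = α ℚ.* fromℕ n ℚ.<? fromℕ (ent (cycle n ∪ toGraph M))
    many : ∀ M → ¬ Splittable n t σ (proj₁ M) → α ℚ.* fromℕ n ℚ.< fromℕ (ent (cycle n ∪ toGraph M))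
    many M ¬s = *fromℕ-< D n (ent (cycle n ∪ toGraph M)) (ℕ.<-≤-trans n<
        (ℕ.*-monoʳ-≤ D (t<ent n t σ M fits ¬s 0<σ 9σ≤n)))
      where
      -- Rounding down in `t` is harmless: the remainder is less than `D`, and `ent` is at least
      -- `suc t`.
      n< : n < D * suc t
      n< = subst (_< D * suc t) (sym n≡) (ℕ.<-≤-trans (ℕ.+-monoˡ-< (D * t) (m%n<n n D))
             (ℕ.≤-reflexive (sym (ℕ.*-suc D t))))
    bad≤ : count (¬? ∘ Many?) (perfectMatchings n) ≤ count (splittable? n t σ) (matchings n)
    bad≤ = begin
      count (¬? ∘ Many?) (perfectMatchings n)
        ≤⟨ count-mono (¬? ∘ Many?) (splittable? n t σ ∘ proj₁) (perfectMatchings n)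
             (λ {M} _ ¬m → decidable-stable (splittable? n t σ (proj₁ M)) (¬m ∘ many M)) ⟩
      count (splittable? n t σ ∘ proj₁) (perfectMatchings n)
        ≡⟨ count-map (splittable? n t σ) proj₁ (perfectMatchings n) ⟨
      count (splittable? n t σ) (map proj₁ (perfectMatchings n))
        ≡⟨ cong (count (splittable? n t σ)) (map-perfectMatchings n) ⟩
      count (splittable? n t σ) (matchings n)
        ∎
      where open ℕ.≤-Reasoning

corollary2 : ∃[ α ] 0ℚ ℚ.< α ×
    (∀ (ε : ℚ) → 0ℚ ℚ.< ε →
    ∃[ N ] (∀ (n : ℕ) → N ≤ n → 2 ∣ n →
    ℚ.∣ Pr (perfectMatchings n) (λ M → α ℚ.* fromℕ n ℚ.<? fromℕ (ent (cycle n ∪ toGraph M))) ℚ.- 1ℚ ∣ ℚ.< ε))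
corollary2 =
  -- `α` is 1 / 6000 because `D` is 40 * 150. The hidden witness for `N` is the threshold
  -- `D * suc (K * ↧ₙ ε)` of `ent-linear`.
  α 2000 150 decay , ℚ.positive⁻¹ _ {{ℚ.normalize-pos 1 6000}} , λ ε 0<ε → _ , ent-linear 2000 150 decay ε 0<ε
  where
  -- True since (2002 / 2000)⁴⁰ · 65 / 72 < 0.94 and 4000 · 0.94¹⁵⁰ < 1.
  decay : 2 * ((2000 + 2) ^ (40 * 150) * 2000 * 65 ^ 150) ≤ 2000 ^ (40 * 150) * 72 ^ 150
  decay = ℕ.≤ᵇ⇒≤ _ _ _
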